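{- Let $B$ be a graphic matroid. Then the es-splitting matroid $B_X^e$ is a binary gammoid for every $X \subseteq E(B)$ with $|X| \geq 2$ and every $e \in X$ if and only if $B$ has no minor isomorphic to $M(G_8)$, where $G_8$ is the graph with vertices $t,a,b$ and four edges: one edge between $t$ and $a$, one edge between $t$ and $b$, and two parallel edges between $a$ and $b$.
   Context: Element splitting: let $D$ be a binary matroid represented over $GF(2)$ by a matrix $N$, and let $X \subseteq E(D)$. Let $N_X'$ be obtained from $N$ by appending a new last row with entry $1$ in the columns of the elements of $X$ and $0$ elsewhere, and then appending a new column labelled $q$ with entry $1$ in the new row and $0$ elsewhere; the element splitting matroid is $D_X' = M(N_X')$. es-splitting: let $B$ be a binary matroid represented by a matrix $A$, $X \subseteq E(B)$ and $e \in X$. Let $N$ be obtained from $A$ by adding a new column labelled $\gamma$ identical to the column of $e$, and let $D = M(N)$. The es-splitting matroid $B_X^e$ is the element splitting matroid $D_X'$ (with $X$ viewed as a subset of $E(D)$). A binary gammoid is a matroid that is both binary and a gammoid (equivalently, one with no minor isomorphic to $U_{2,4}$ or $M(K_4)$). $M(G)$ is the cycle matroid of $G$. -}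

module Defs where

open import Data.Nat using (ℕ; zero; suc; _<_; _≤_)
open import Data.Nat.Properties using (_<?_)
open import Data.Bool using (Bool; true; false; _∧_; _∨_; _xor_)
open import Data.Fin using (Fin; zero; suc; toℕ; fromℕ; fromℕ<; inject₁; _≟_)
open import Data.Fin.Subset using (Subset; _∈_; _∉_; _⊆_; _∪_; Nonempty)
open import Data.Vec using (Vec; _∷_; lookup; tabulate)
open import Data.Product using (Σ; ∃; ∃-syntax; _×_; _,_)
open import Data.Sum using (_⊎_)
open import Relation.Binary.PropositionalEquality using (_≡_; _≢_)
open import Relation.Nullary using (¬_; yes; no)
open import Relation.Nullary.Decidable using (⌊_⌋)
open import Function.Bundles using (_⇔_)
open import Function.Definitions using (Injective)

xorFin : ∀ {m} → (Fin m → Bool) → Bool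
xorFin {zero}  f = false
xorFin {suc m} f = f zero xor xorFin (λ j → f (suc j))

anyFin : ∀ {m} → (Fin m → Bool) → Bool
anyFin {zero}  f = false
anyFin {suc m} f = f zero ∨ anyFin (λ j → f (suc j))

image : ∀ {m n} → (Fin m → Fin n) → Subset m → Subset n
image f I = tabulate λ x → anyFin (λ y → lookup I y ∧ ⌊ f y ≟ x ⌋)

-- Matroids on the ground set Fin n, given by their independent sets.
-- (Every matroid occurring below is graphic, a minor of a matroid, or
--  a vector matroid, so the matroid axioms hold automatically.)

Matroid : ℕ → Set₁
Matroid n = Subset n → Set

-- Matrices over GF(2) = Bool (with xor as addition, ∧ as product)

Matrix : ℕ → ℕ → Set
Matrix r n = Fin r → Fin n → Bool

colSum : ∀ {r n} → Matrix r n → Subset n → Fin r → Bool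
colSum A T i = xorFin (λ j → lookup T j ∧ A i j)

LinIndep : ∀ {r n} → Matrix r n → Subset n → Set
LinIndep A I = ∀ T → T ⊆ I → Nonempty T → ∃[ i ] colSum A T i ≡ true

VecMatroid : ∀ {r n} → Matrix r n → Matroid n
VecMatroid A = LinIndep A

Represents : ∀ {r n} → Matrix r n → Matroid n → Set
Represents A M = ∀ I → M I ⇔ LinIndep A I

IsBinary : ∀ {n} → Matroid n → Set
IsBinary {n} M = ∃[ r ] Σ (Matrix r n) λ A → Represents A M

record Graph (n : ℕ) : Set where
  field
    nV   : ℕ
    ends : Fin n → Fin nV × Fin nV
open Graph public

Joins : ∀ {n} (G : Graph n) → Fin n → Fin (nV G) → Fin (nV G) → Set
Joins G e u w = ends G e ≡ (u , w) ⊎ ends G e ≡ (w , u)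

next : ∀ {k} → Fin (suc k) → Fin (suc k)
next {k} i with toℕ i <? k
... | yes p = suc (fromℕ< p)
... | no  _ = zero

-- a cycle of G: distinct vertices v₀,…,v_k and distinct edges e₀,…,e_k
-- with eᵢ joining vᵢ and v_{i+1 mod (k+1)} (k = 0: a loop;
-- k = 1: a pair of parallel edges)
record Cycle {n} (G : Graph n) : Set where
  field
    k      : ℕ
    vs     : Fin (suc k) → Fin (nV G)
    es     : Fin (suc k) → Fin n
    vs-inj : Injective _≡_ _≡_ vs
    es-inj : Injective _≡_ _≡_ es
    joins  : ∀ i → Joins G (es i) (vs i) (vs (next i))

CycleMatroid : ∀ {n} → Graph n → Matroid n
CycleMatroid G I = ¬ (Σ (Cycle G) λ C → ∀ i → Cycle.es C i ∈ I)

IsGraphic : ∀ {n} → Matroid n → Set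
IsGraphic {n} B = Σ (Graph n) λ G → ∀ I → B I ⇔ CycleMatroid G I

-- Minors: M has a minor isomorphic to N.
-- M / C \ D with C, D disjoint; I is independent in M / C iff
-- I ∪ B_C is independent in M, where B_C is a maximal independent
-- subset of C.  The isomorphism is f : E(N) → E(M) − (C ∪ D).

HasMinor : ∀ {n m} → Matroid n → Matroid m → Set
HasMinor {n} {m} M N =
  Σ (Subset n) λ C → Σ (Subset n) λ D →
  (∀ x → x ∈ C → x ∉ D) ×
  Σ (Subset n) λ BC → BC ⊆ C × M BC ×
  (∀ x → x ∈ C → x ∉ BC → ¬ M (BC ∪ Data.Fin.Subset.⁅ x ⁆)) ×
  Σ (Fin m → Fin n) λ f → Injective _≡_ _≡_ f ×
  (∀ y → f y ∉ C × f y ∉ D) ×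
  (∀ x → x ∉ C → x ∉ D → ∃[ y ] f y ≡ x) ×
  (∀ I → N I ⇔ M (image f I ∪ BC))

record Digraph : Set where
  field
    nW  : ℕ
    arc : Fin nW → Fin nW → Bool
open Digraph public

record DPath (Γ : Digraph) : Set where
  field
    len   : ℕ
    vtx   : Fin (suc len) → Fin (nW Γ)
    steps : ∀ (i : Fin len) → arc Γ (vtx (inject₁ i)) (vtx (suc i)) ≡ true

start end : ∀ {Γ} → DPath Γ → Fin (nW Γ)
start P = DPath.vtx P zero
end   P = DPath.vtx P (fromℕ (DPath.len P))

VertexDisjoint : ∀ {Γ} → DPath Γ → DPath Γ → Set
VertexDisjoint P Q = ∀ i j → DPath.vtx P i ≢ DPath.vtx Q j

Linked : ∀ {n} (Γ : Digraph) → (Fin n → Fin (nW Γ)) → Subset (nW Γ) → Subset n → Set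
Linked {n} Γ emb T I =
  Σ (Fin n → DPath Γ) λ P →
    (∀ x → x ∈ I → start (P x) ≡ emb x × end (P x) ∈ T) ×
    (∀ x y → x ∈ I → y ∈ I → x ≢ y → VertexDisjoint (P x) (P y))

IsGammoid : ∀ {n} → Matroid n → Set
IsGammoid {n} M =
  Σ Digraph λ Γ → Σ (Fin n → Fin (nW Γ)) λ emb → Injective _≡_ _≡_ emb ×
  Σ (Subset (nW Γ)) λ T → ∀ I → M I ⇔ Linked Γ emb T I

IsBinaryGammoid : ∀ {n} → Matroid n → Set
IsBinaryGammoid M = IsBinary M × IsGammoid M

-- N'_X : new first row with 1 exactly in the columns of X, and new first
-- column q = (1,0,…,0)ᵀ.  Column zero is q, column suc j is old column j.
elementSplit : ∀ {r m} → Matrix r m → Subset m → Matrix (suc r) (suc m)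
elementSplit N X zero    zero    = true
elementSplit N X zero    (suc j) = lookup X j
elementSplit N X (suc i) zero    = false
elementSplit N X (suc i) (suc j) = N i j

addParallel : ∀ {r n} → Matrix r n → Fin n → Matrix r (suc n)
addParallel A e i zero    = A i e
addParallel A e i (suc j) = A i j

-- es-splitting matrix: element splitting of [A | γ] w.r.t. X ⊆ E(B)
-- (γ ∉ X).  Columns: zero = q, suc zero = γ, suc (suc j) = element j of B.
esSplit : ∀ {r n} → Matrix r n → Subset n → Fin n → Matrix (suc r) (suc (suc n))
esSplit A X e = elementSplit (addParallel A e) (false ∷ X)

-- G₈: vertices t = 0, a = 1, b = 2; edges ta, tb, ab, ab

G₈ : Graph 4
G₈ = record { nV = 3 ; ends = E }
  where
  E : Fin 4 → Fin 3 × Fin 3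
  E zero                   = zero , suc zero
  E (suc zero)             = zero , suc (suc zero)
  E (suc (suc zero))       = suc zero , suc (suc zero)
  E (suc (suc (suc zero))) = suc zero , suc (suc zero)

{-# OPTIONS --safe #-}

-- (⇐) Let A represent B. If a circuit of size at least three meets a cycle in a proper nonempty part, the cycle
-- can be chosen so that their union is a theta, which contracts to G₈. So without a G₈ minor every circuit of size
-- at least three is a connected component. A digraph presenting the es-splitting as a strict gammoid is then grown
-- element by element, starting with q, γ, e: an element outside the span of the earlier ones becomes a new sink,
-- and any other element w gets arcs to D − w for a suitable cycle D through w.
--
-- (⇒) If B has a G₈ minor with contracted basis BC, take X = {ta, ab₁} and e = ta: contracting BC in the
-- es-splitting leaves M(K₄) on {q, γ, ta, tb, ab₁, ab₂}. Gammoids are base orderable, but no bijection between the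
-- bases {q, γ, tb} ∪ BC and {ta, ab₂, ab₁} ∪ BC has the symmetric exchange property.

module Submission where

open import Defs
open import Data.Nat using (ℕ; zero; suc; _≤_; _<_; _+_; z≤n; s≤s)
import Data.Nat.Properties as ℕ
open import Data.Bool using (Bool; true; false; _∧_; _xor_; not; if_then_else_)
import Data.Bool as Bool
open import Data.Bool.Properties using (xor-same; xor-comm; xor-assoc; xor-identityʳ; ∧-distribʳ-xor; ∧-zeroʳ; ∧-identityʳ; ∧-comm; ¬-not)
open import Data.Fin using (Fin; zero; suc; _≟_; toℕ; fromℕ; fromℕ<; inject₁; join; splitAt)
open import Data.Fin.Properties using (any?; all?; toℕ-injective; toℕ-fromℕ<; toℕ-inject₁; toℕ-fromℕ; toℕ<n; toℕ≤pred[n]; injective⇒≤; pigeonhole; splitAt-join; suc-injective)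
open import Data.Fin.Subset using (Subset; _∈_; _∉_; _⊂_; _∪_; ∣_∣; ⁅_⁆)
open import Data.Fin.Subset.Properties using (anySubset?; _∈?_; x∈p∪q⁻; x∈p∪q⁺; ∣⁅x⁆∣≡1; p⊂q⇒∣p∣<∣q∣; x∈⁅y⁆⇒x≡y)
open import Data.Fin.Subset.Induction using (⊂-wellFounded)
open import Data.Vec using (lookup; tabulate; []; _∷_; here; there)
open import Data.Vec.Properties using (lookup∘tabulate; []=⇒lookup; lookup⇒[]=)
import Data.Vec.Functional as F
open import Data.Product using (Σ; ∃; ∃-syntax; _×_; _,_; proj₁; proj₂)
open import Data.Product.Properties using (,-injective)
open import Data.Sum using (_⊎_; inj₁; inj₂; [_,_]′)
open import Data.Sum.Properties using (inj₁-injective; inj₂-injective; ≡-dec)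
open import Data.Empty using (⊥; ⊥-elim)
open import Data.Unit using (⊤; tt)
open import Function using (_∘_; id)
open import Function.Bundles using (_⇔_; mk⇔; Equivalence)
open import Function.Definitions using (Injective)
open import Induction.WellFounded using (Acc; acc)
open import Relation.Binary.PropositionalEquality
open import Relation.Nullary using (¬_; Dec; yes; no; contradiction)
open import Relation.Nullary.Decidable using (⌊_⌋; _×-dec_; _⊎-dec_; _→-dec_; ¬?; map′)

-- Linear algebra over GF(2)

-- Independence is handled as `Free`: no nonzero cycle is supported in the set. Ranks and closures
-- do not appear; where a basis would be chosen, the support of a cycle is minimised instead.
--
-- Arcs from w to D - w make w a generic point of a flat. This agrees with the matrix as soon as
-- every earlier cycle through some d in D contains a cycle meeting D in d alone. Usually an earlier
-- cycle shares at most one fixed element with D, because circuits of B with three or more elements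
-- are components and only q, γ and e can interfere. The delicate case is an element j parallel in B
-- to an earlier i, with the other entry in the new row and no earlier copy of its column: then D =
-- {q, i, j}, and q and i can lie in a common earlier cycle.
--
-- For (⇒), graphicness supplies a representing matrix to which the assumption can be applied. The
-- set X = {ta, ab₁} is met evenly by {ta, tb, ab₁} and by {γ, tb, ab₂}, and oddly by {ab₁, ab₂} and
-- by {γ, ta}. So the last two gain q, and all four become triangles, those of K₄.

Chain : ℕ → Set
Chain n = Fin n → Bool

infix 4 _∋_ _⊑_

_∋_ : ∀ {n} → Chain n → Fin n → Set
f ∋ j = f j ≡ true

_⊑_ : ∀ {n} → Chain n → (Fin n → Set) → Set
f ⊑ P = ∀ j → f ∋ j → P j

infixl 6 _⊕_
_⊕_ : ∀ {n} → Chain n → Chain n → Chain n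
(f ⊕ g) j = f j xor g j

δ : ∀ {n} → Fin n → Chain n
δ i j = ⌊ i ≟ j ⌋

true⊎false : ∀ b → b ≡ true ⊎ b ≡ false
true⊎false true  = inj₁ refl
true⊎false false = inj₂ refl

true≢false : ∀ {b} → b ≡ true → b ≡ false → ⊥
true≢false refl ()

∧-true : ∀ {a b} → a ∧ b ≡ true → a ≡ true × b ≡ true
∧-true {true} {true} refl = refl , refl

not-true : ∀ {a} → not a ≡ true → a ≡ false
not-true {false} refl = refl

δ-refl : ∀ {n} (i : Fin n) → δ i ∋ i
δ-refl i with i ≟ i
... | yes _  = refl
... | no i≢i = contradiction refl i≢i

δ-≢ : ∀ {n} {i j : Fin n} → i ≢ j → δ i j ≡ false
δ-≢ {i = i} {j} i≢j with i ≟ j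
... | yes i≡j = contradiction i≡j i≢j
... | no _    = refl

δ⇒≡ : ∀ {n} {i j : Fin n} → δ i ∋ j → i ≡ j
δ⇒≡ {i = i} {j} p with i ≟ j
... | yes i≡j = i≡j

xorFin-cong : ∀ {m} {f g : Chain m} → f ≗ g → xorFin f ≡ xorFin g
xorFin-cong {zero}  f≗g = refl
xorFin-cong {suc m} f≗g = cong₂ _xor_ (f≗g zero) (xorFin-cong (f≗g ∘ suc))

xorFin-false : ∀ {m} {f : Chain m} → (∀ j → f j ≡ false) → xorFin f ≡ false
xorFin-false {zero}  p = refl
xorFin-false {suc m} p rewrite p zero = xorFin-false (p ∘ suc)

xor-interchange : ∀ a b c d → (a xor b) xor (c xor d) ≡ (a xor c) xor (b xor d)
xor-interchange a b c d = begin
  (a xor b) xor (c xor d)  ≡⟨ xor-assoc a b (c xor d) ⟩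
  a xor (b xor (c xor d))  ≡⟨ cong (a xor_) (xor-assoc b c d) ⟨
  a xor ((b xor c) xor d)  ≡⟨ cong (λ z → a xor (z xor d)) (xor-comm b c) ⟩
  a xor ((c xor b) xor d)  ≡⟨ cong (a xor_) (xor-assoc c b d) ⟩
  a xor (c xor (b xor d))  ≡⟨ xor-assoc a c (b xor d) ⟨
  (a xor c) xor (b xor d)  ∎
  where open ≡-Reasoning

xorFin-xor : ∀ {m} (f g : Chain m) → xorFin (f ⊕ g) ≡ xorFin f xor xorFin g
xorFin-xor {zero}  f g = refl
xorFin-xor {suc m} f g = trans
  (cong ((f zero xor g zero) xor_) (xorFin-xor (f ∘ suc) (g ∘ suc)))
  (xor-interchange (f zero) (g zero) _ _)

xorFin-single : ∀ {m} (f : Chain m) i → (∀ j → j ≢ i → f j ≡ false) → xorFin f ≡ f i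
xorFin-single f zero    p =
  trans (cong (f zero xor_) (xorFin-false (λ j → p (suc j) λ ()))) (xor-identityʳ (f zero))
xorFin-single f (suc i) p rewrite p zero (λ ()) =
  xorFin-single (f ∘ suc) i λ j j≢i → p (suc j) λ { refl → j≢i refl }

xorFin-another : ∀ {m} (f : Chain m) i → xorFin f ≡ false → f ∋ i → ∃[ j ] j ≢ i × f ∋ j
xorFin-another f i Σ≡0 fi with any? (λ j → ¬? (j ≟ i) ×-dec (f j Bool.≟ true))
... | yes p  = p
... | no ¬p = ⊥-elim (true≢false (trans (xorFin-single f i only) fi) Σ≡0)
  where
  only : ∀ j → j ≢ i → f j ≡ false
  only j j≢i = ¬-not λ fj → ¬p (j , j≢i , fj)

dot : ∀ {n} → Chain n → Chain n → Bool
dot f r = xorFin (λ j → f j ∧ r j)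

dot-cong : ∀ {n} {f g : Chain n} r → f ≗ g → dot f r ≡ dot g r
dot-cong r f≗g = xorFin-cong λ j → cong (_∧ r j) (f≗g j)

dot-⊕ : ∀ {n} (f g r : Chain n) → dot (f ⊕ g) r ≡ dot f r xor dot g r
dot-⊕ f g r = trans (xorFin-cong λ j → ∧-distribʳ-xor (r j) (f j) (g j))
  (xorFin-xor (λ j → f j ∧ r j) (λ j → g j ∧ r j))

dot-δ : ∀ {n} (i : Fin n) r → dot (δ i) r ≡ r i
dot-δ i r = trans
  (xorFin-single _ i λ j j≢i → cong (_∧ r j) (δ-≢ (j≢i ∘ sym)))
  (cong (_∧ r i) (δ-refl i))

Cyc : ∀ {r n} → Matrix r n → Chain n → Set
Cyc A f = ∀ i → dot f (A i) ≡ false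

Cyc-cong : ∀ {r n} (A : Matrix r n) {f g} → f ≗ g → Cyc A f → Cyc A g
Cyc-cong A f≗g c i = trans (sym (dot-cong (A i) f≗g)) (c i)

Cyc-⊕ : ∀ {r n} (A : Matrix r n) {f g} → Cyc A f → Cyc A g → Cyc A (f ⊕ g)
Cyc-⊕ A {f} {g} cf cg i = trans (dot-⊕ f g (A i)) (cong₂ _xor_ (cf i) (cg i))

Cyc? : ∀ {r n} (A : Matrix r n) f → Dec (Cyc A f)
Cyc? A f = all? λ i → dot f (A i) Bool.≟ false

Cyc-pair : ∀ {r n} (A : Matrix r n) {x y} → (∀ i → A i x ≡ A i y) → Cyc A (δ x ⊕ δ y)
Cyc-pair A {x} {y} eq i = begin
  dot (δ x ⊕ δ y) (A i)               ≡⟨ dot-⊕ (δ x) (δ y) (A i) ⟩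
  dot (δ x) (A i) xor dot (δ y) (A i) ≡⟨ cong₂ _xor_ (dot-δ x (A i)) (dot-δ y (A i)) ⟩
  A i x xor A i y                     ≡⟨ cong (_xor A i y) (eq i) ⟩
  A i y xor A i y                     ≡⟨ xor-same (A i y) ⟩
  false                               ∎
  where open ≡-Reasoning

-- Independence for sets given by a predicate, so that sets such as I - w + d need no tabulation.
Free : ∀ {r n} → Matrix r n → (Fin n → Set) → Set
Free A P = ∀ f → Cyc A f → f ⊑ P → ∀ j → f j ≡ false

Free-mono : ∀ {r n} (A : Matrix r n) {P Q : Fin n → Set} → (∀ j → P j → Q j) → Free A Q → Free A P
Free-mono A P⊆Q free f cf f⊑P = free f cf λ j fj → P⊆Q j (f⊑P j fj)

∈⇒lookup : ∀ {n} {S : Subset n} {j} → j ∈ S → lookup S ∋ j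
∈⇒lookup = []=⇒lookup

lookup⇒∈ : ∀ {n} {S : Subset n} {j} → lookup S ∋ j → j ∈ S
lookup⇒∈ {S = S} {j} = lookup⇒[]= j S

∈-tabulate⁺ : ∀ {n} {f : Chain n} {j} → f ∋ j → j ∈ tabulate f
∈-tabulate⁺ {f = f} {j} fj = lookup⇒∈ (trans (lookup∘tabulate f j) fj)

∈-tabulate⁻ : ∀ {n} {f : Chain n} {j} → j ∈ tabulate f → f ∋ j
∈-tabulate⁻ {f = f} {j} j∈ = trans (sym (lookup∘tabulate f j)) (∈⇒lookup j∈)

Free⇒LinIndep : ∀ {r n} (A : Matrix r n) {I} → Free A (_∈ I) → LinIndep A I
Free⇒LinIndep A {I} free T T⊆I (x , x∈T)
  with any? (λ i → colSum A T i Bool.≟ true)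
... | yes p  = p
... | no ¬p = ⊥-elim (true≢false (∈⇒lookup x∈T)
    (free (lookup T) (λ i → ¬-not λ q → ¬p (i , q)) (λ j p → T⊆I (lookup⇒∈ p)) x))

LinIndep⇒Free : ∀ {r n} (A : Matrix r n) {I} → LinIndep A I → Free A (_∈ I)
LinIndep⇒Free A {I} ind f cf f⊑I j = ¬-not λ fj →
  let i , p = ind (tabulate f) (λ x∈ → f⊑I _ (∈-tabulate⁻ x∈)) (j , ∈-tabulate⁺ fj)
  in true≢false p (trans (dot-cong (A i) (lookup∘tabulate f)) (cf i))

-- Minimal members of decidable families of chains

Ext : ∀ {n} → (Chain n → Set) → Set
Ext P = ∀ {f g} → f ≗ g → P f → P g

-- The search runs over `Subset`; a chain read back from its table agrees with the original only
-- pointwise, hence `Ext`.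
anyChain? : ∀ {n} {P : Chain n → Set} → Ext P → (∀ f → Dec (P f)) → Dec (∃ P)
anyChain? ext P? with anySubset? (P? ∘ lookup)
... | yes (S , p) = yes (lookup S , p)
... | no ¬p      = no λ (f , p) → ¬p (tabulate f , ext (sym ∘ lookup∘tabulate f) p)

infix 4 _≼[_]_
-- Elements of `K` cost nothing. `K` will be a circuit `C` for the cycles crossing `C`, an
-- independent set for the exchange property, and empty for circuits.
_≼[_]_ : ∀ {n} → Chain n → (Fin n → Bool) → Chain n → Set
g ≼[ K ] f = ∀ j → K j ≡ false → g ∋ j → f ∋ j

IsMinimal : ∀ {n} → (Chain n → Set) → Chain n → Chain n → Set
IsMinimal P K f = P f × (∀ g → P g → g ≼[ K ] f → f ≼[ K ] g)

≼? : ∀ {n} (K g f : Chain n) → Dec (g ≼[ K ] f)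
≼? K g f = all? λ j → (K j Bool.≟ false) →-dec ((g j Bool.≟ true) →-dec (f j Bool.≟ true))

minimal : ∀ {n} {P : Chain n → Set} → Ext P → (∀ f → Dec (P f)) → ∀ K → ∃ P → ∃ (IsMinimal P K)
minimal {n} {P} ext P? K (f , p) = go f p (⊂-wellFounded (offK f))
  where
  offK : Chain n → Subset n
  offK f = tabulate λ j → f j ∧ not (K j)
  out⁺ : ∀ {f j} → K j ≡ false → f ∋ j → j ∈ offK f
  out⁺ {f} {j} kj fj = ∈-tabulate⁺ (cong₂ (λ a b → a ∧ not b) fj kj)
  out⁻ : ∀ {f j} → j ∈ offK f → K j ≡ false × f ∋ j
  out⁻ {f} {j} j∈ with fj , kj ← ∧-true {f j} (∈-tabulate⁻ {f = λ j → f j ∧ not (K j)} j∈) = not-true kj , fj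
  Smaller : Chain n → Chain n → Set
  Smaller f g = P g × g ≼[ K ] f × ¬ (f ≼[ K ] g)
  smaller? : ∀ f → Dec (∃ (Smaller f))
  smaller? f = anyChain?
    (λ g≗h (p , le , nle) → ext g≗h p , (λ j k hj → le j k (trans (g≗h j) hj)) ,
      λ le' → nle λ j k fj → trans (g≗h j) (le' j k fj))
    (λ g → P? g ×-dec ≼? K g f ×-dec ¬? (≼? K f g))
  go : ∀ f → P f → Acc _⊂_ (offK f) → ∃ (IsMinimal P K)
  go f p (acc rec) with smaller? f
  ... | no ¬s = f , p , λ g pg le → decide g pg le
    where
    decide : ∀ g → P g → g ≼[ K ] f → f ≼[ K ] g
    decide g pg le with ≼? K f g
    ... | yes q = q
    ... | no ¬q = ⊥-elim (¬s (g , pg , le , ¬q))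
  ... | yes (g , pg , le , nle) = go g pg (rec smaller)
    where
    witness : ∃[ j ] K j ≡ false × f ∋ j × g j ≡ false
    witness with any? (λ j → (K j Bool.≟ false) ×-dec ((f j Bool.≟ true) ×-dec (g j Bool.≟ false)))
    ... | yes w = w
    ... | no ¬w = ⊥-elim (nle λ j k fj → ¬-not λ gj → ¬w (j , k , fj , gj))
    smaller : offK g ⊂ offK f
    smaller = (λ x∈ → let k , gx = out⁻ x∈ in out⁺ k (le _ k gx)) ,
      let j , k , fj , gj = witness in j , out⁺ k fj , λ j∈ → true≢false (proj₂ (out⁻ j∈)) gj

-- Cycle matroids

-- The incidence column of a loop is zero.
incidence : ∀ {n} (G : Graph n) → Matrix (nV G) n
incidence G v e = δ (proj₁ (ends G e)) v xor δ (proj₂ (ends G e)) v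

incidence-joins : ∀ {n} (G : Graph n) {e u w} → Joins G e u w → ∀ v → incidence G v e ≡ δ u v xor δ w v
incidence-joins G (inj₁ eq) v rewrite eq = refl
incidence-joins G {u = u} {w} (inj₂ eq) v rewrite eq = xor-comm (δ w v) (δ u v)

Joins-unique : ∀ {n} (G : Graph n) {e a b c d} → Joins G e a b → Joins G e c d →
               (a ≡ c × b ≡ d) ⊎ (a ≡ d × b ≡ c)
Joins-unique G (inj₁ p) (inj₁ q) = inj₁ (,-injective (trans (sym p) q))
Joins-unique G (inj₁ p) (inj₂ q) = inj₂ (,-injective (trans (sym p) q))
Joins-unique G (inj₂ p) (inj₁ q) with b≡c , a≡d ← ,-injective (trans (sym p) q) = inj₂ (a≡d , b≡c)
Joins-unique G (inj₂ p) (inj₂ q) with b≡d , a≡c ← ,-injective (trans (sym p) q) = inj₁ (a≡c , b≡d)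

otherEnd : ∀ {n} (G : Graph n) {e v} → incidence G v e ≡ true → ∃[ w ] Joins G e w v × w ≢ v
otherEnd G {e} {v} inc with ends G e
... | a , b with a ≟ v | b ≟ v
...   | yes refl | no b≢v   = b , inj₂ refl , b≢v
...   | no a≢v   | yes refl = a , inj₁ refl , a≢v

-- Multiplicities mod 2. With them `dot-multiset` holds for every `g`; injectivity matters only for
-- the chain to be nonzero.
multiset : ∀ {m n} → (Fin m → Fin n) → Chain n
multiset {zero}  g j = false
multiset {suc m} g   = δ (g zero) ⊕ multiset (g ∘ suc)

multiset-∋ : ∀ {m n} (g : Fin m → Fin n) {j} → multiset g ∋ j → ∃[ i ] g i ≡ j
multiset-∋ {suc m} g {j} p with g zero ≟ j
... | yes q = zero , q
... | no  _ with i , q ← multiset-∋ (g ∘ suc) p = suc i , q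

multiset-injective : ∀ {m n} (g : Fin (suc m) → Fin n) → Injective _≡_ _≡_ g → multiset g ∋ g zero
multiset-injective g inj = cong₂ _xor_ (δ-refl (g zero))
  (¬-not λ p → 1+i≢0 (inj (proj₂ (multiset-∋ (g ∘ suc) p))))
  where
  1+i≢0 : ∀ {m} {i : Fin m} → suc i ≢ zero
  1+i≢0 ()

dot-multiset : ∀ {m n} (g : Fin m → Fin n) r → dot (multiset g) r ≡ xorFin (r ∘ g)
dot-multiset {zero}  g r = xorFin-false {f = λ j → multiset g j ∧ r j} λ _ → refl
dot-multiset {suc m} g r = trans (dot-⊕ (δ (g zero)) (multiset (g ∘ suc)) r)
  (cong₂ _xor_ (dot-δ (g zero) r) (dot-multiset (g ∘ suc) r))

xorFin-last : ∀ {m} (f : Chain (suc m)) → xorFin f ≡ xorFin (f ∘ inject₁) xor f (fromℕ m)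
xorFin-last {zero}  f = xor-identityʳ (f zero)
xorFin-last {suc m} f = trans (cong (f zero xor_) (xorFin-last (f ∘ suc)))
  (sym (xor-assoc (f zero) _ _))

next-inject₁ : ∀ {k} (i : Fin k) → next (inject₁ i) ≡ suc i
next-inject₁ {k} i with toℕ (inject₁ i) ℕ.<? k
... | yes p = cong suc (toℕ-injective (trans (toℕ-fromℕ< p) (toℕ-inject₁ i)))
... | no ¬p = contradiction (subst (_< k) (sym (toℕ-inject₁ i)) (toℕ<n i)) ¬p

next-fromℕ : ∀ k → next (fromℕ k) ≡ zero
next-fromℕ k with toℕ (fromℕ k) ℕ.<? k
... | yes p = contradiction (subst (_< k) (toℕ-fromℕ k) p) (ℕ.<-irrefl refl)
... | no _  = refl

xorFin-next : ∀ {k} (f : Chain (suc k)) → xorFin (f ∘ next) ≡ xorFin f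
xorFin-next {k} f = begin
  xorFin (f ∘ next)                                       ≡⟨ xorFin-last (f ∘ next) ⟩
  xorFin (f ∘ next ∘ inject₁) xor f (next (fromℕ k))      ≡⟨ cong₂ _xor_ (xorFin-cong (cong f ∘ next-inject₁)) (cong f (next-fromℕ k)) ⟩
  xorFin (f ∘ suc) xor f zero                             ≡⟨ xor-comm _ (f zero) ⟩
  xorFin f                                                ∎
  where open ≡-Reasoning

-- Around a cycle the second ends of the edges are the first ends rotated by `next`, so the two
-- contributions to each row cancel.
Free⇒acyclic : ∀ {n} (G : Graph n) {I} → Free (incidence G) (_∈ I) → CycleMatroid G I
Free⇒acyclic G {I} free (C , es∈I) = true≢false
  (multiset-injective es es-inj)
  (free (multiset es) cyc (λ j p → let i , q = multiset-∋ es p in subst (_∈ I) q (es∈I i)) (es zero))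
  where
  open Cycle C
  cyc : Cyc (incidence G) (multiset es)
  cyc v = begin
    dot (multiset es) (incidence G v)                                     ≡⟨ dot-multiset es (incidence G v) ⟩
    xorFin (λ i → incidence G v (es i))                                   ≡⟨ xorFin-cong (λ i → incidence-joins G (joins i) v) ⟩
    xorFin (λ i → δ (vs i) v xor δ (vs (next i)) v)                       ≡⟨ xorFin-xor (λ i → δ (vs i) v) (λ i → δ (vs (next i)) v) ⟩
    xorFin (λ i → δ (vs i) v) xor xorFin (λ i → δ (vs (next i)) v)        ≡⟨ cong (xorFin (λ i → δ (vs i) v) xor_) (xorFin-next (λ i → δ (vs i) v)) ⟩
    xorFin (λ i → δ (vs i) v) xor xorFin (λ i → δ (vs i) v)               ≡⟨ xor-same (xorFin (λ i → δ (vs i) v)) ⟩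
    false                                                                 ∎
    where open ≡-Reasoning

module _ {n} (G : Graph n) (f : Chain n) (cf : Cyc (incidence G) f) where

  CycleIn : Set
  CycleIn = Σ (Cycle G) λ C → ∀ i → f ∋ Cycle.es C i

  -- A path v₀ e₀ v₁ … e_{m-1} v_m; only the indices up to m matter.
  record SimplePath (m : ℕ) : Set where
    field
      vs    : ℕ → Fin (nV G)
      es    : ℕ → Fin n
      inj   : ∀ {i j} → i ≤ m → j ≤ m → vs i ≡ vs j → i ≡ j
      es∈f  : ∀ {i} → i < m → f ∋ es i
      joins : ∀ {i} → i < m → Joins G (es i) (vs i) (vs (suc i))

  module _ {m} (p : SimplePath m) {e w} (fe : f ∋ e) (e≢ : e ≢ SimplePath.es p 0)
           (je : Joins G e w (SimplePath.vs p 0)) where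
    open SimplePath p

    -- Distinct vertices force distinct edges with one exception: `e` may be `es 0` traversed
    -- backwards. This is what `e≢` excludes.
    closePath : ∀ {j} → j ≤ m → vs j ≡ w → CycleIn
    closePath {j} j≤m refl = record { k = j ; vs = vs ∘ toℕ ; es = es′
        ; vs-inj = λ {a} {b} eq → toℕ-injective (inj (bound a) (bound b) eq)
        ; es-inj = λ {a} {b} → es′-inj a b ; joins = joins′ } , es′∈f
      where
      bound : ∀ (a : Fin (suc j)) → toℕ a ≤ m
      bound a = ℕ.≤-trans (toℕ≤pred[n] a) j≤m
      es′ : Fin (suc j) → Fin n
      es′ i with toℕ i ℕ.<? j
      ... | yes _ = es (toℕ i)
      ... | no _  = e
      es′∈f : ∀ i → f ∋ es′ i
      es′∈f i with toℕ i ℕ.<? j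
      ... | yes i<j = es∈f (ℕ.<-≤-trans i<j j≤m)
      ... | no _    = fe
      last : ∀ (i : Fin (suc j)) → ¬ (toℕ i < j) → toℕ i ≡ j
      last i i≮j = ℕ.≤-antisym (toℕ≤pred[n] i) (ℕ.≮⇒≥ i≮j)
      joins′ : ∀ i → Joins G (es′ i) (vs (toℕ i)) (vs (toℕ (next i)))
      joins′ i with toℕ i ℕ.<? j
      ... | yes i<j = subst (λ z → Joins G (es (toℕ i)) (vs (toℕ i)) (vs (suc z)))
                        (sym (toℕ-fromℕ< i<j)) (joins (ℕ.<-≤-trans i<j j≤m))
      ... | no i≮j  = subst (λ z → Joins G e (vs z) (vs 0)) (sym (last i i≮j)) je
      es-inj : ∀ {a b} → a < j → b < j → es a ≡ es b → a ≡ b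
      es-inj {a} {b} a<j b<j eq with Joins-unique G (joins (ℕ.<-≤-trans a<j j≤m))
          (subst (λ z → Joins G z (vs b) (vs (suc b))) (sym eq) (joins (ℕ.<-≤-trans b<j j≤m)))
      ... | inj₁ (q , _) = inj (ℕ.<⇒≤ (ℕ.<-≤-trans a<j j≤m)) (ℕ.<⇒≤ (ℕ.<-≤-trans b<j j≤m)) q
      ... | inj₂ (q , r) with refl ← inj (ℕ.<⇒≤ (ℕ.<-≤-trans a<j j≤m)) (ℕ.<-≤-trans b<j j≤m) q
        = contradiction (inj (ℕ.<-≤-trans a<j j≤m) (ℕ.<⇒≤ (ℕ.<-≤-trans b<j j≤m)) r)
            λ eq′ → ℕ.<-irrefl (sym eq′) (ℕ.m<n⇒m<1+n (ℕ.n<1+n b))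
      e≢es : ∀ {a} → a < j → e ≢ es a
      e≢es {a} a<j eq with Joins-unique G je
          (subst (λ z → Joins G z (vs a) (vs (suc a))) (sym eq) (joins (ℕ.<-≤-trans a<j j≤m)))
      ... | inj₁ (_ , r) with () ← inj z≤n (ℕ.<-≤-trans a<j j≤m) r
      ... | inj₂ (_ , r) with refl ← inj z≤n (ℕ.<⇒≤ (ℕ.<-≤-trans a<j j≤m)) r = e≢ eq
      es′-inj : ∀ a b → es′ a ≡ es′ b → a ≡ b
      es′-inj a b eq with toℕ a ℕ.<? j | toℕ b ℕ.<? j
      ... | yes a<j | yes b<j = toℕ-injective (es-inj a<j b<j eq)
      ... | yes a<j | no _    = contradiction (sym eq) (e≢es a<j)
      ... | no _    | yes b<j = contradiction eq (e≢es b<j)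
      ... | no a≮j  | no b≮j  = toℕ-injective (trans (last a a≮j) (sym (last b b≮j)))

    extendPath : (∀ {j} → j ≤ m → vs j ≢ w) → SimplePath (suc m)
    extendPath new = record { vs = vs′ ; es = es′ ; inj = λ {i} {j} → inj′ i j ; es∈f = λ {i} → es′∈f i ; joins = λ {i} → joins′ i }
      where
      vs′ : ℕ → Fin (nV G)
      vs′ zero    = w
      vs′ (suc i) = vs i
      es′ : ℕ → Fin n
      es′ zero    = e
      es′ (suc i) = es i
      inj′ : ∀ i j → i ≤ suc m → j ≤ suc m → vs′ i ≡ vs′ j → i ≡ j
      inj′ zero    zero    _ _ _ = refl
      inj′ zero    (suc j) _ (s≤s q) eq = contradiction (sym eq) (new q)
      inj′ (suc i) zero    (s≤s q) _ eq = contradiction eq (new q)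
      inj′ (suc i) (suc j) (s≤s q) (s≤s r) eq = cong suc (inj q r eq)
      es′∈f : ∀ i → i < suc m → f ∋ es′ i
      es′∈f zero    _       = fe
      es′∈f (suc i) (s≤s q) = es∈f q
      joins′ : ∀ i → i < suc m → Joins G (es′ i) (vs′ i) (vs′ (suc i))
      joins′ zero    _       = je
      joins′ (suc i) (s≤s q) = joins q

  -- The row of `vs 0` has even sum over `f`, and `es 0` contributes to it, being no loop as `vs 0`
  -- and `vs 1` differ.
  another : ∀ {m} (p : SimplePath (suc m)) → let open SimplePath p in
            ∃[ e ] ∃[ w ] f ∋ e × e ≢ es 0 × Joins G e w (vs 0)
  another p = e , w , proj₁ (∧-true {f e} q) , e≢ , je
    where
    open SimplePath p
    first : incidence G (vs 0) (es 0) ≡ true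
    first = trans (incidence-joins G (joins (s≤s z≤n)) (vs 0))
      (cong₂ _xor_ (δ-refl (vs 0)) (δ-≢ λ eq → ℕ.1+n≢0 (inj (s≤s z≤n) z≤n eq)))
    found = xorFin-another (λ e → f e ∧ incidence G (vs 0) e) (es 0) (cf (vs 0))
      (cong₂ _∧_ (es∈f (s≤s z≤n)) first)
    e = proj₁ found
    e≢ = proj₁ (proj₂ found)
    q = proj₂ (proj₂ found)
    far = otherEnd G {e} {vs 0} (proj₂ (∧-true {f e} q))
    w = proj₁ far
    je = proj₁ (proj₂ far)

  findCycle : ∀ fuel {m} → nV G ≤ suc m + fuel → SimplePath (suc m) → CycleIn
  findCycle fuel {m} bound p with e , w , fe , e≢ , je ← another p
    with any? (λ (j : Fin (suc (suc m))) → SimplePath.vs p (toℕ j) ≟ w)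
  ... | yes (j , eq) = closePath p fe e≢ je (toℕ≤pred[n] j) eq
  ... | no new with fuel
  ...   | suc fuel′ = findCycle fuel′ (subst (nV G ≤_) (ℕ.+-suc (suc m) fuel′) bound) (extendPath p fe e≢ je
            λ j≤ eq → new (fromℕ< (s≤s j≤) , trans (cong (SimplePath.vs p) (toℕ-fromℕ< (s≤s j≤))) eq))
  ...   | zero = contradiction
            (ℕ.≤-trans (injective⇒≤ λ {a} {b} eq → toℕ-injective (SimplePath.inj p (toℕ≤pred[n] a) (toℕ≤pred[n] b) eq))
              (subst (nV G ≤_) (ℕ.+-identityʳ (suc m)) bound))
            (ℕ.<-irrefl refl)

  evenSet⇒cycle : ∀ {e} → f ∋ e → CycleIn
  evenSet⇒cycle {e} fe with ends G e in eq
  ... | u , w with u ≟ w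
  ...   | yes refl = record { k = 0 ; vs = λ _ → u ; es = λ _ → e
            ; vs-inj = λ { {zero} {zero} _ → refl } ; es-inj = λ { {zero} {zero} _ → refl }
            ; joins = λ { zero → inj₁ eq } } , λ _ → fe
  ...   | no u≢w = findCycle (nV G) (ℕ.m≤n+m (nV G) 1) record
            { vs = vs ; es = λ _ → e ; inj = λ {i} {j} → inj i j ; es∈f = λ _ → fe
            ; joins = λ { {zero} _ → inj₁ eq ; {suc i} (s≤s ()) } }
    where
    vs : ℕ → Fin (nV G)
    vs zero    = u
    vs (suc _) = w
    inj : ∀ i j → i ≤ 1 → j ≤ 1 → vs i ≡ vs j → i ≡ j
    inj zero zero _ _ _ = refl
    inj zero (suc j) _ _ q = contradiction q u≢w
    inj (suc i) zero _ _ q = contradiction (sym q) u≢w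
    inj (suc zero) (suc zero) _ _ _ = refl
    inj (suc (suc _)) _ (s≤s ()) _ _
    inj (suc zero) (suc (suc _)) _ (s≤s ()) _

acyclic⇒Free : ∀ {n} (G : Graph n) {I} → CycleMatroid G I → Free (incidence G) (_∈ I)
acyclic⇒Free G acyclic f cf f⊑I j = ¬-not λ fj →
  let C , es∈f = evenSet⇒cycle G f cf fj in acyclic (C , λ i → f⊑I _ (es∈f i))

incidence-represents : ∀ {n} (G : Graph n) → Represents (incidence G) (CycleMatroid G)
incidence-represents G I = mk⇔ (Free⇒LinIndep (incidence G) ∘ acyclic⇒Free G)
                               (Free⇒acyclic G ∘ LinIndep⇒Free (incidence G))

-- Producing a G₈ minor

xor≡false⇒≡ : ∀ {a b} → a xor b ≡ false → a ≡ b
xor≡false⇒≡ {true}  {true}  _ = refl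
xor≡false⇒≡ {false} {false} _ = refl

xor-move : ∀ {a b c} → a xor b ≡ c → a ≡ c xor b
xor-move {true}  {true}  refl = refl
xor-move {true}  {false} refl = refl
xor-move {false} {true}  refl = refl
xor-move {false} {false} refl = refl

xor-true : ∀ {a b} → a xor b ≡ true → a ≡ true ⊎ b ≡ true
xor-true {true}  _ = inj₁ refl
xor-true {false} p = inj₂ p

anyFin⁺ : ∀ {m} {g : Chain m} y → g ∋ y → anyFin g ≡ true
anyFin⁺ {g = g} zero    p rewrite p = refl
anyFin⁺ {g = g} (suc y) p with g zero
... | true  = refl
... | false = anyFin⁺ y p

anyFin⁻ : ∀ {m} {g : Chain m} → anyFin g ≡ true → ∃[ y ] g ∋ y
anyFin⁻ {suc m} {g} p with g zero in eq
... | true  = zero , eq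
... | false with y , q ← anyFin⁻ {m} {g ∘ suc} p = suc y , q

∈-image⁺ : ∀ {m n} (f : Fin m → Fin n) {I y} → y ∈ I → f y ∈ image f I
∈-image⁺ f {y = y} y∈I = ∈-tabulate⁺ (anyFin⁺ y (cong₂ _∧_ (∈⇒lookup y∈I) (δ-refl (f y))))

∈-image⁻ : ∀ {m n} (f : Fin m → Fin n) {I x} → x ∈ image f I → ∃[ y ] y ∈ I × f y ≡ x
∈-image⁻ f {I} x∈ with y , p ← anyFin⁻ (∈-tabulate⁻ x∈)
  with q , r ← ∧-true {lookup I y} p = y , lookup⇒∈ q , δ⇒≡ r

⌊⌋-true : ∀ {P : Set} (d : Dec P) → P → ⌊ d ⌋ ≡ true
⌊⌋-true (yes _) _ = refl
⌊⌋-true (no ¬p) p = contradiction p ¬p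

true-⌊⌋ : ∀ {P : Set} (d : Dec P) → ⌊ d ⌋ ≡ true → P
true-⌊⌋ (yes p) _ = p

subsetOf : ∀ {n} {P : Fin n → Set} → (∀ j → Dec (P j)) → Subset n
subsetOf P? = tabulate λ j → ⌊ P? j ⌋

∈-subsetOf⁺ : ∀ {n} {P : Fin n → Set} (P? : ∀ j → Dec (P j)) {j} → P j → j ∈ subsetOf P?
∈-subsetOf⁺ P? {j} p = ∈-tabulate⁺ (⌊⌋-true (P? j) p)

∈-subsetOf⁻ : ∀ {n} {P : Fin n → Set} (P? : ∀ j → Dec (P j)) {j} → j ∈ subsetOf P? → P j
∈-subsetOf⁻ P? {j} j∈ = true-⌊⌋ (P? j) (∈-tabulate⁻ {f = λ j → ⌊ P? j ⌋} j∈)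

Zero : ∀ {n} → Chain n → Set
Zero f = ∀ j → f j ≡ false

IsCircuit : ∀ {r n} → Matrix r n → Chain n → Set
IsCircuit A C = Cyc A C × (∀ h → Cyc A h → h ⊑ (C ∋_) → Zero h ⊎ h ≗ C)

G₈-cycles : ∀ g → Cyc (incidence G₈) g →
  let a = g zero ; b = g (suc zero) ; c = g (suc (suc zero)) ; d = g (suc (suc (suc zero))) in
  a ≡ b × a ≡ c xor d
G₈-cycles g cg = row-t a b c d (cg zero) , row-a a b c d (cg (suc zero))
  where
  a = g zero
  b = g (suc zero)
  c = g (suc (suc zero))
  d = g (suc (suc (suc zero)))
  row-t : ∀ a b c d → (a ∧ true) xor ((b ∧ true) xor ((c ∧ false) xor ((d ∧ false) xor false))) ≡ false → a ≡ b
  row-t a b c d p rewrite ∧-zeroʳ c | ∧-zeroʳ d | ∧-identityʳ a | ∧-identityʳ b | xor-identityʳ b = xor≡false⇒≡ p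
  row-a : ∀ a b c d → (a ∧ true) xor ((b ∧ false) xor ((c ∧ true) xor ((d ∧ true) xor false))) ≡ false → a ≡ c xor d
  row-a a b c d p rewrite ∧-zeroʳ b | ∧-identityʳ a | ∧-identityʳ c | ∧-identityʳ d | xor-identityʳ d = xor≡false⇒≡ p

three : ∀ {P : Fin 3 → Set} → P zero → P (suc zero) → P (suc (suc zero)) → ∀ i → P i
three a b c zero             = a
three a b c (suc zero)       = b
three a b c (suc (suc zero)) = c

quad : ∀ {X : Set} → X → X → X → X → Fin 4 → X
quad a b c d zero                   = a
quad a b c d (suc zero)             = b
quad a b c d (suc (suc zero))       = c
quad a b c d (suc (suc (suc zero))) = d

quad-≗ : ∀ {X : Set} (g : Fin 4 → X) {a b c d} → g zero ≡ a → g (suc zero) ≡ b → g (suc (suc zero)) ≡ c →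
         g (suc (suc (suc zero))) ≡ d → g ≗ quad a b c d
quad-≗ g p q r s zero                   = p
quad-≗ g p q r s (suc zero)             = q
quad-≗ g p q r s (suc (suc zero))       = r
quad-≗ g p q r s (suc (suc (suc zero))) = s

module _ {r n} {A : Matrix r n} {B : Matroid n} (rep : Represents A B)
         {C : Chain n} (circ : IsCircuit A C) where

  Crosses : Chain n → Set
  Crosses T = Cyc A T × (∃[ u ] C ∋ u × T ∋ u) × (∃[ v ] C ∋ v × T v ≡ false)

  Crosses-ext : Ext Crosses
  Crosses-ext f≗g (c , (u , cu , fu) , (v , cv , fv)) =
    Cyc-cong A f≗g c , (u , cu , trans (sym (f≗g u)) fu) , (v , cv , trans (sym (f≗g v)) fv)

  Crosses? : ∀ T → Dec (Crosses T)
  Crosses? T = Cyc? A T ×-dec any? (λ u → (C u Bool.≟ true) ×-dec (T u Bool.≟ true))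
                        ×-dec any? (λ u → (C u Bool.≟ true) ×-dec (T u Bool.≟ false))

  module _ {T} (min : IsMinimal Crosses C T) where
    private
      T-cyc = proj₁ (proj₁ min)

    InUnion : Fin n → Set
    InUnion j = C ∋ j ⊎ T ∋ j

    -- `T ⊕ h` crosses `C` in the same elements as `T`, and off `C` it is `T` without `h`;
    -- minimality of `T` leaves nothing for `h`.
    disjoint⇒zero : ∀ h → Cyc A h → h ⊑ InUnion → (∀ j → C ∋ j → h j ≡ false) → Zero h
    disjoint⇒zero h ch h⊑ avoids j = ¬-not λ hj →
      let Tj = [ (λ Cj → ⊥-elim (true≢false hj (avoids j Cj))) , (λ Tj → Tj) ]′ (h⊑ j hj) in
      true≢false (proj₂ min (T ⊕ h) crosses below j (¬-not λ Cj → true≢false hj (avoids j Cj)) Tj)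
        (trans (cong₂ _xor_ Tj hj) refl)
      where
      agree : ∀ {j} → C ∋ j → (T ⊕ h) j ≡ T j
      agree {j} Cj = trans (cong (T j xor_) (avoids j Cj)) (xor-identityʳ (T j))
      crosses : Crosses (T ⊕ h)
      crosses with cT , (u , Cu , Tu) , (v , Cv , Tv) ← proj₁ min =
        Cyc-⊕ A cT ch , (u , Cu , trans (agree Cu) Tu) , (v , Cv , trans (agree Cv) Tv)
      below : T ⊕ h ≼[ C ] T
      below j Cj p with xor-true {T j} p
      ... | inj₁ Tj = Tj
      ... | inj₂ hj with h⊑ j hj
      ...   | inj₁ Cj′ = ⊥-elim (true≢false Cj′ Cj)
      ...   | inj₂ Tj  = Tj

    -- C ∪ T is a theta: its cycle space is {0, C, T, C ⊕ T}.
    theta-cycles : ∀ h → Cyc A h → h ⊑ InUnion → Zero h ⊎ h ≗ C ⊎ h ≗ T ⊎ h ≗ C ⊕ T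
    theta-cycles h ch h⊑ with any? (λ u → (C u Bool.≟ true) ×-dec (h u Bool.≟ true))
    ... | no ¬p = inj₁ (disjoint⇒zero h ch h⊑ λ j Cj → ¬-not λ hj → ¬p (j , Cj , hj))
    ... | yes p with any? (λ u → (C u Bool.≟ true) ×-dec (h u Bool.≟ false))
    ...   | no ¬q = inj₂ (inj₁ λ j → xor≡false⇒≡ (disjoint⇒zero (h ⊕ C) (Cyc-⊕ A ch (proj₁ circ))
              (λ j p → [ h⊑ j , inj₁ ]′ (xor-true {h j} p))
              (λ j Cj → cong₂ _xor_ (¬-not {h j} {false} λ hj → ¬q (j , Cj , hj)) Cj) j))
    -- Now `h` crosses `C` itself. By minimality it agrees with `T` off `C`, so `h ⊕ T` is a cycle
    -- inside the circuit `C`.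
    ...   | yes q with proj₂ circ (h ⊕ T) (Cyc-⊕ A ch T-cyc) inside
      where
      h≼T : h ≼[ C ] T
      h≼T j Cj hj with h⊑ j hj
      ... | inj₁ Cj′ = ⊥-elim (true≢false Cj′ Cj)
      ... | inj₂ Tj  = Tj
      T≼h : T ≼[ C ] h
      T≼h = proj₂ min h (ch , p , q) h≼T
      inside : h ⊕ T ⊑ (C ∋_)
      inside j p = ¬-not λ Cj → [ (λ hj → true≢false p (cong₂ _xor_ hj (h≼T j Cj hj)))
                                , (λ Tj → true≢false p (cong₂ _xor_ (T≼h j Cj Tj) Tj)) ]′ (xor-true {h j} p)
    ...     | inj₁ z = inj₂ (inj₂ (inj₁ λ j → xor≡false⇒≡ (z j)))
    ...     | inj₂ e = inj₂ (inj₂ (inj₂ λ j → xor-move (e j)))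

    -- The three paths of the theta are C - T, C ∩ T and T - C. The first keeps a and b and becomes
    -- the path a-t-b of G₈; the other two keep u and v and become the parallel edges. The remaining
    -- elements of the theta form an independent set `BC`, which is contracted and is its own basis;
    -- everything outside the theta is deleted.
    theta⇒minor : ∀ {a b u} → a ≢ b → C ∋ a → T a ≡ false → C ∋ b → T b ≡ false → C ∋ u → T ∋ u →
                  HasMinor B (CycleMatroid G₈)
    theta⇒minor {a} {b} {u} a≢b Ca Ta Cb Tb Cu Tu =
      BC , deleted , (λ x x∈ x∈′ → ∈-subsetOf⁻ deleted? x∈′ (proj₁ (∈-subsetOf⁻ BC? x∈))) ,
      BC , (λ x∈ → x∈) , toB (λ h ch h⊑ → determined h ch (λ j hj → proj₁ (∈-subsetOf⁻ BC? (h⊑ j hj)))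
             λ y → ¬-not λ hy → proj₂ (∈-subsetOf⁻ BC? (h⊑ _ hy)) (y , refl)) ,
      (λ x x∈ x∉ → contradiction x∈ x∉) ,
      f , f-inj , (λ y → (λ fy∈ → proj₂ (∈-subsetOf⁻ BC? fy∈) (y , refl)) , λ fy∈ → ∈-subsetOf⁻ deleted? fy∈ (f∈ y)) ,
      covers , λ I → mk⇔ (toB ∘ forth I ∘ acyclic⇒Free G₈) (Free⇒acyclic G₈ ∘ back I ∘ fromB)
      where
      toB : ∀ {I} → Free A (_∈ I) → B I
      toB {I} = Equivalence.from (rep I) ∘ Free⇒LinIndep A
      fromB : ∀ {I} → B I → Free A (_∈ I)
      fromB {I} = LinIndep⇒Free A ∘ Equivalence.to (rep I)
      outsideC : ∃[ v ] C v ≡ false × T ∋ v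
      outsideC with any? (λ v → (C v Bool.≟ false) ×-dec (T v Bool.≟ true))
      ... | yes p  = p
      ... | no ¬p with proj₂ circ T T-cyc (λ j Tj → ¬-not λ Cj → ¬p (j , Cj , Tj))
      ...   | inj₁ z = ⊥-elim (true≢false Tu (z u))
      ...   | inj₂ e = ⊥-elim (true≢false (trans (e a) Ca) Ta)
      v = proj₁ outsideC
      Cv = proj₁ (proj₂ outsideC)
      Tv = proj₂ (proj₂ outsideC)
      f : Fin 4 → Fin n
      f = quad a b u v
      f∈ : ∀ y → InUnion (f y)
      f∈ zero                   = inj₁ Ca
      f∈ (suc zero)             = inj₁ Cb
      f∈ (suc (suc zero))       = inj₁ Cu
      f∈ (suc (suc (suc zero))) = inj₂ Tv
      separate : ∀ (h : Chain n) {x y} → h ∋ x → h y ≡ false → x ≢ y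
      separate h hx hy refl = true≢false hx hy
      f-inj′ : ∀ x y → f x ≡ f y → x ≡ y
      f-inj′ zero zero _ = refl
      f-inj′ zero (suc zero) p = contradiction p a≢b
      f-inj′ zero (suc (suc zero)) p = contradiction (sym p) (separate T Tu Ta)
      f-inj′ zero (suc (suc (suc zero))) p = contradiction p (separate C Ca Cv)
      f-inj′ (suc zero) zero p = contradiction (sym p) a≢b
      f-inj′ (suc zero) (suc zero) _ = refl
      f-inj′ (suc zero) (suc (suc zero)) p = contradiction (sym p) (separate T Tu Tb)
      f-inj′ (suc zero) (suc (suc (suc zero))) p = contradiction p (separate C Cb Cv)
      f-inj′ (suc (suc zero)) zero p = contradiction p (separate T Tu Ta)
      f-inj′ (suc (suc zero)) (suc zero) p = contradiction p (separate T Tu Tb)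
      f-inj′ (suc (suc zero)) (suc (suc zero)) _ = refl
      f-inj′ (suc (suc zero)) (suc (suc (suc zero))) p = contradiction p (separate C Cu Cv)
      f-inj′ (suc (suc (suc zero))) zero p = contradiction (sym p) (separate C Ca Cv)
      f-inj′ (suc (suc (suc zero))) (suc zero) p = contradiction (sym p) (separate C Cb Cv)
      f-inj′ (suc (suc (suc zero))) (suc (suc zero)) p = contradiction (sym p) (separate C Cu Cv)
      f-inj′ (suc (suc (suc zero))) (suc (suc (suc zero))) _ = refl
      f-inj : Injective _≡_ _≡_ f
      f-inj {x} {y} = f-inj′ x y
      InUnion? : ∀ j → Dec (InUnion j)
      InUnion? j = (C j Bool.≟ true) ⊎-dec (T j Bool.≟ true)
      BC? : ∀ j → Dec (InUnion j × ¬ (∃[ y ] f y ≡ j))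
      BC? j = InUnion? j ×-dec ¬? (any? λ y → f y ≟ j)
      deleted? : ∀ j → Dec (¬ InUnion j)
      deleted? j = ¬? (InUnion? j)
      BC deleted : Subset n
      BC = subsetOf BC?
      deleted = subsetOf deleted?
      covers : ∀ x → x ∉ BC → x ∉ deleted → ∃[ y ] f y ≡ x
      covers x x∉BC x∉del with any? (λ y → f y ≟ x) | InUnion? x
      ... | yes p | _      = p
      ... | no ¬p | yes q  = contradiction (∈-subsetOf⁺ BC? (q , ¬p)) x∉BC
      ... | no ¬p | no ¬q  = contradiction (∈-subsetOf⁺ deleted? ¬q) x∉del
      C∘f : C ∘ f ≗ quad true true true false
      C∘f = quad-≗ (C ∘ f) Ca Cb Cu Cv
      T∘f : T ∘ f ≗ quad false false true true
      T∘f = quad-≗ (T ∘ f) Ta Tb Tu Tv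
      C⊕T∘f : (C ⊕ T) ∘ f ≗ quad true true false true
      C⊕T∘f = quad-≗ ((C ⊕ T) ∘ f) (cong₂ _xor_ Ca Ta) (cong₂ _xor_ Cb Tb) (cong₂ _xor_ Cu Tu) (cong₂ _xor_ Cv Tv)
      restrict : ∀ h → Cyc A h → h ⊑ InUnion → Cyc (incidence G₈) (h ∘ f)
      restrict h ch h⊑ with theta-cycles h ch h⊑
      ... | inj₁ z = Cyc-cong (incidence G₈) (sym ∘ quad-≗ (h ∘ f) (z a) (z b) (z u) (z v)) (three refl refl refl)
      ... | inj₂ (inj₁ e) = Cyc-cong (incidence G₈) (λ y → sym (trans (e (f y)) (C∘f y))) (three refl refl refl)
      ... | inj₂ (inj₂ (inj₁ e)) = Cyc-cong (incidence G₈) (λ y → sym (trans (e (f y)) (T∘f y))) (three refl refl refl)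
      ... | inj₂ (inj₂ (inj₂ e)) = Cyc-cong (incidence G₈) (λ y → sym (trans (e (f y)) (C⊕T∘f y))) (three refl refl refl)
      determined : ∀ h → Cyc A h → h ⊑ InUnion → (∀ y → h (f y) ≡ false) → Zero h
      determined h ch h⊑ hf with theta-cycles h ch h⊑
      ... | inj₁ z = z
      ... | inj₂ (inj₁ e) = ⊥-elim (true≢false (trans (e a) Ca) (hf zero))
      ... | inj₂ (inj₂ (inj₁ e)) = ⊥-elim (true≢false (trans (e u) Tu) (hf (suc (suc zero))))
      ... | inj₂ (inj₂ (inj₂ e)) = ⊥-elim (true≢false (trans (e a) (cong₂ _xor_ Ca Ta)) (hf zero))
      lift : ∀ g → Cyc (incidence G₈) g → ∃[ h ] Cyc A h × h ⊑ InUnion × h ∘ f ≗ g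
      lift g cg with g zero in g0 | g (suc zero) in g1 | g (suc (suc zero)) in g2 | g (suc (suc (suc zero))) in g3 | G₈-cycles g cg
      ... | true  | _ | true  | false | refl , _ = C , proj₁ circ , (λ _ → inj₁) , λ y → trans (C∘f y) (sym (quad-≗ g g0 g1 g2 g3 y))
      ... | true  | _ | false | true  | refl , _ = C ⊕ T , Cyc-⊕ A (proj₁ circ) T-cyc , (λ j → xor-true {C j}) ,
              λ y → trans (C⊕T∘f y) (sym (quad-≗ g g0 g1 g2 g3 y))
      ... | false | _ | true  | true  | refl , _ = T , T-cyc , (λ _ → inj₂) , λ y → trans (T∘f y) (sym (quad-≗ g g0 g1 g2 g3 y))
      ... | false | _ | false | false | refl , _ = (λ _ → false) , (λ i → xorFin-false {f = λ j → false ∧ A i j} λ _ → refl) , (λ _ ()) ,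
              λ y → trans (quad-≗ (λ _ → false) refl refl refl refl y) (sym (quad-≗ g g0 g1 g2 g3 y))
      forth : ∀ I → Free (incidence G₈) (_∈ I) → Free A (_∈ image f I ∪ BC)
      forth I free h ch h⊑ = determined h ch h⊑′ (free (h ∘ f) (restrict h ch h⊑′) inI)
        where
        h⊑′ : h ⊑ InUnion
        h⊑′ j hj with x∈p∪q⁻ (image f I) BC (h⊑ j hj)
        ... | inj₂ j∈ = proj₁ (∈-subsetOf⁻ BC? j∈)
        ... | inj₁ j∈ with y , _ , refl ← ∈-image⁻ f {I} j∈ = f∈ y
        inI : h ∘ f ⊑ (_∈ I)
        inI y hy with x∈p∪q⁻ (image f I) BC (h⊑ (f y) hy)
        ... | inj₂ y∈ = contradiction (y , refl) (proj₂ (∈-subsetOf⁻ BC? y∈))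
        ... | inj₁ y∈ with y′ , y′∈ , eq ← ∈-image⁻ f {I} y∈ = subst (_∈ I) (f-inj eq) y′∈
      back : ∀ I → Free A (_∈ image f I ∪ BC) → Free (incidence G₈) (_∈ I)
      back I free g cg g⊑ with h , ch , h⊑ , eq ← lift g cg = λ y → trans (sym (eq y)) (free h ch h⊑′ (f y))
        where
        h⊑′ : h ⊑ (_∈ image f I ∪ BC)
        h⊑′ j hj with any? (λ y → f y ≟ j)
        ... | yes (y , refl) = x∈p∪q⁺ (inj₁ (∈-image⁺ f (g⊑ y (trans (sym (eq y)) hj))))
        ... | no ¬p          = x∈p∪q⁺ (inj₂ (∈-subsetOf⁺ BC? (h⊑ j hj , ¬p)))

  -- Among three elements of `C` two lie on the same side of a minimal `T`. If that side is inside
  -- `T`, pass to `T ⊕ C`: it equals `T` off `C`, hence is minimal too, and the sides are exchanged.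
  Crosses⇒minor : ∀ {x y z T} → x ≢ y → y ≢ z → x ≢ z → C ∋ x → C ∋ y → C ∋ z → Crosses T →
                  HasMinor B (CycleMatroid G₈)
  Crosses⇒minor {x} {y} {z} x≢y y≢z x≢z Cx Cy Cz crosses
    with T , min@((cT , (u , Cu , Tu) , (v , Cv , Tv)) , least) ← minimal Crosses-ext Crosses? C (_ , crosses)
    = pick (true⊎false (T x)) (true⊎false (T y)) (true⊎false (T z))
    where
    out : ∀ {a b} → a ≢ b → C ∋ a → C ∋ b → T a ≡ false → T b ≡ false → HasMinor B (CycleMatroid G₈)
    out a≢b Ca Cb Ta Tb = theta⇒minor min a≢b Ca Ta Cb Tb Cu Tu
    offC : ∀ {j} → C j ≡ false → (T ⊕ C) j ≡ T j
    offC {j} Cj = trans (cong (T j xor_) Cj) (xor-identityʳ (T j))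
    min′ : IsMinimal Crosses C (T ⊕ C)
    min′ = (Cyc-⊕ A cT (proj₁ circ) , (v , Cv , cong₂ _xor_ Tv Cv) , (u , Cu , cong₂ _xor_ Tu Cu)) ,
      λ g cg le j Cj p → least g cg (λ j Cj gj → trans (sym (offC Cj)) (le j Cj gj)) j Cj (trans (sym (offC Cj)) p)
    in′ : ∀ {a b} → a ≢ b → C ∋ a → C ∋ b → T ∋ a → T ∋ b → HasMinor B (CycleMatroid G₈)
    in′ a≢b Ca Cb Ta Tb = theta⇒minor min′ a≢b Ca (cong₂ _xor_ Ta Ca) Cb (cong₂ _xor_ Tb Cb) Cv (cong₂ _xor_ Tv Cv)
    pick : T ∋ x ⊎ T x ≡ false → T ∋ y ⊎ T y ≡ false → T ∋ z ⊎ T z ≡ false → HasMinor B (CycleMatroid G₈)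
    pick (inj₁ p) (inj₁ q) _        = in′ x≢y Cx Cy p q
    pick (inj₁ p) (inj₂ q) (inj₁ r) = in′ x≢z Cx Cz p r
    pick (inj₁ p) (inj₂ q) (inj₂ r) = out y≢z Cy Cz q r
    pick (inj₂ p) (inj₁ q) (inj₁ r) = in′ y≢z Cy Cz q r
    pick (inj₂ p) (inj₁ q) (inj₂ r) = out x≢z Cx Cz p r
    pick (inj₂ p) (inj₂ q) _        = out x≢y Cx Cy p q

-- Strict gammoids built one element at a time

data Path {W : Set} (arc : W → W → Set) (T : W → Set) : W → Set where
  stop : ∀ {v} → T v → Path arc T v
  step : ∀ {v w} → arc v w → Path arc T w → Path arc T v

data _on_ {W : Set} {arc : W → W → Set} {T : W → Set} (z : W) : ∀ {v} → Path arc T v → Set where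
  here  : {p : Path arc T z} → z on p
  there : ∀ {v w} {a : arc v w} {p : Path arc T w} → z on p → z on step a p

-- `Linked` with inductive paths, given for members of `I` only, and with relations for arcs and
-- sinks. Without lengths and indices, dropping or prepending a vertex is a constructor.
LinkedAt : ∀ {W E : Set} → (W → W → Set) → (W → Set) → (E → W) → (E → Set) → Set
LinkedAt arc T emb I = Σ (∀ x → I x → Path arc T (emb x)) λ P →
  ∀ {x y} ix iy → x ≢ y → ∀ {z} → z on P x ix → z on P y iy → ⊥

module _ {W : Set} {arc arc′ : W → W → Set} {T T′ : W → Set} (Q : W → Set)
         (T⇒ : ∀ {v} → Q v → T v → T′ v) (arc⇒ : ∀ {v w} → Q v → arc v w → arc′ v w × Q w) where

  mapPath : ∀ {v} → Q v → Path arc T v → Path arc′ T′ v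
  mapPath q (stop t)   = stop (T⇒ q t)
  mapPath q (step a p) = step (proj₁ (arc⇒ q a)) (mapPath (proj₂ (arc⇒ q a)) p)

  on-mapPath : ∀ {v z} (q : Q v) (p : Path arc T v) → z on mapPath q p → z on p
  on-mapPath q (stop t)   here      = here
  on-mapPath q (step a p) here      = here
  on-mapPath q (step a p) (there o) = there (on-mapPath (proj₂ (arc⇒ q a)) p o)

  mapLinked : ∀ {E : Set} {emb : E → W} {I} → (∀ x → I x → Q (emb x)) →
              LinkedAt arc T emb I → LinkedAt arc′ T′ emb I
  mapLinked I⊆Q (P , disj) = (λ x ix → mapPath (I⊆Q x ix) (P x ix)) ,
    λ ix iy x≢y o o′ → disj ix iy x≢y (on-mapPath _ _ o) (on-mapPath _ _ o′)

on⇒closed : ∀ {W : Set} {arc : W → W → Set} {T : W → Set} {Q : W → Set} → (∀ {v w} → Q v → arc v w → Q w) →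
            ∀ {v z} → Q v → (p : Path arc T v) → z on p → Q z
on⇒closed arc⇒ q p          here      = q
on⇒closed arc⇒ q (step a p) (there o) = on⇒closed arc⇒ (arc⇒ q a) p o

module _ {Γ : Digraph} {T : Subset (nW Γ)} where

  GPath : Fin (nW Γ) → Set
  GPath = Path (λ u v → arc Γ u v ≡ true) (_∈ T)

  private
    fromVertices : ∀ l (vtx : Fin (suc l) → Fin (nW Γ)) → (∀ i → arc Γ (vtx (inject₁ i)) (vtx (suc i)) ≡ true) →
                   vtx (fromℕ l) ∈ T → GPath (vtx zero)
    fromVertices zero    vtx steps t = stop t
    fromVertices (suc l) vtx steps t = step (steps zero) (fromVertices l (vtx ∘ suc) (steps ∘ suc) t)

    on-fromVertices : ∀ l vtx steps t {z} → z on fromVertices l vtx steps t → ∃[ i ] vtx i ≡ z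
    on-fromVertices zero    vtx steps t here = zero , refl
    on-fromVertices (suc l) vtx steps t here = zero , refl
    on-fromVertices (suc l) vtx steps t (there o) with i , eq ← on-fromVertices l (vtx ∘ suc) (steps ∘ suc) t o = suc i , eq

  fromDPath : ∀ (P : DPath Γ) {v} → start P ≡ v → end P ∈ T → GPath v
  fromDPath P refl t = fromVertices _ (DPath.vtx P) (DPath.steps P) t

  on-fromDPath : ∀ (P : DPath Γ) {v} (s : start P ≡ v) t {z} → z on fromDPath P s t → ∃[ i ] DPath.vtx P i ≡ z
  on-fromDPath P refl t = on-fromVertices _ (DPath.vtx P) (DPath.steps P) t

  length : ∀ {v} → GPath v → ℕ
  length (stop _)   = zero
  length (step _ p) = suc (length p)

  vertex : ∀ {v} (p : GPath v) → Fin (suc (length p)) → Fin (nW Γ)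
  vertex {v} p          zero    = v
  vertex     (step _ p) (suc i) = vertex p i

  vertex-step : ∀ {v} (p : GPath v) i → arc Γ (vertex p (inject₁ i)) (vertex p (suc i)) ≡ true
  vertex-step (step a p) zero    = a
  vertex-step (step a p) (suc i) = vertex-step p i

  vertex-last : ∀ {v} (p : GPath v) → vertex p (fromℕ (length p)) ∈ T
  vertex-last (stop t)   = t
  vertex-last (step a p) = vertex-last p

  vertex-on : ∀ {v} (p : GPath v) i → vertex p i on p
  vertex-on p          zero    = here
  vertex-on (step a p) (suc i) = there (vertex-on p i)

  toDPath : ∀ {v} → GPath v → DPath Γ
  toDPath p = record { len = length p ; vtx = vertex p ; steps = vertex-step p }

  Linked⇒LinkedAt : ∀ {n} {emb : Fin n → Fin (nW Γ)} {I} → Linked Γ emb T I →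
                    LinkedAt (λ u v → arc Γ u v ≡ true) (_∈ T) emb (_∈ I)
  Linked⇒LinkedAt (P , endpoints , disj) =
    (λ x x∈I → fromDPath (P x) (proj₁ (endpoints x x∈I)) (proj₂ (endpoints x x∈I))) ,
    λ {x} {y} ix iy x≢y o o′ →
      let i , p = on-fromDPath (P x) (proj₁ (endpoints x ix)) (proj₂ (endpoints x ix)) o
          j , q = on-fromDPath (P y) (proj₁ (endpoints y iy)) (proj₂ (endpoints y iy)) o′ in
      disj x y ix iy x≢y i j (trans p (sym q))

  LinkedAt⇒Linked : ∀ {n} {emb : Fin n → Fin (nW Γ)} {I} →
                    LinkedAt (λ u v → arc Γ u v ≡ true) (_∈ T) emb (_∈ I) → Linked Γ emb T I
  LinkedAt⇒Linked {n} {emb} {I} (P , disj) = Q , endpoints , disj′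
    where
    Q : Fin n → DPath Γ
    Q x with x ∈? I
    ... | yes x∈I = toDPath (P x x∈I)
    -- `Linked` wants a path for every element; outside `I` a trivial one satisfies it.
    ... | no _    = record { len = 0 ; vtx = λ _ → emb x ; steps = λ () }
    endpoints : ∀ x → x ∈ I → start (Q x) ≡ emb x × end (Q x) ∈ T
    endpoints x ix with x ∈? I
    ... | yes x∈I = refl , vertex-last (P x x∈I)
    ... | no x∉I  = contradiction ix x∉I
    disj′ : ∀ x y → x ∈ I → y ∈ I → x ≢ y → VertexDisjoint (Q x) (Q y)
    disj′ x y ix iy x≢y with x ∈? I | y ∈? I
    ... | yes x∈I | yes y∈I = λ i j eq → disj x∈I y∈I x≢y (vertex-on (P x x∈I) i)
          (subst (_on P y y∈I) (sym eq) (vertex-on (P y y∈I) j))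
    ... | no x∉I  | _       = contradiction ix x∉I
    ... | _       | no y∉I  = contradiction iy y∉I

-- One-element extensions of a presentation

module _ {r N} (M : Matrix r N) where

  -- The restriction of M to S is the strict gammoid of a digraph on S.
  record Presented (S : Fin N → Set) : Set₁ where
    field
      arcs     : Fin N → Fin N → Set
      arcs?    : ∀ u v → Dec (arcs u v)
      sinks    : Fin N → Set
      sinks?   : ∀ v → Dec (sinks v)
      arcs⊆    : ∀ {u v} → arcs u v → S u × S v
      sinks⊆   : ∀ {v} → sinks v → S v
      sound    : ∀ {I} → (∀ x → Dec (I x)) → (∀ x → I x → S x) → LinkedAt arcs sinks id I → Free M I
      complete : ∀ {I} → (∀ x → Dec (I x)) → (∀ x → I x → S x) → Free M I → LinkedAt arcs sinks id I

  Presented-∅ : Presented (λ _ → ⊥)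
  Presented-∅ = record { arcs = λ _ _ → ⊥ ; arcs? = λ _ _ → no id ; sinks = λ _ → ⊥ ; sinks? = λ _ → no id
    ; arcs⊆ = λ () ; sinks⊆ = λ () ; sound = λ _ I⊆∅ _ f _ f⊑I j → ¬-not λ fj → I⊆∅ j (f⊑I j fj)
    ; complete = λ _ I⊆∅ _ → (λ x ix → ⊥-elim (I⊆∅ x ix)) , λ {x} ix → ⊥-elim (I⊆∅ x ix) }

  Presented-resp : ∀ {S S′ : Fin N → Set} → (∀ x → S x → S′ x) → (∀ x → S′ x → S x) → Presented S → Presented S′
  Presented-resp to from pr = record { arcs = arcs ; arcs? = arcs? ; sinks = sinks ; sinks? = sinks?
    ; arcs⊆ = λ a → let p , q = arcs⊆ a in to _ p , to _ q ; sinks⊆ = λ t → to _ (sinks⊆ t)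
    ; sound = λ I? I⊆ → sound I? (λ x ix → from x (I⊆ x ix))
    ; complete = λ I? I⊆ → complete I? (λ x ix → from x (I⊆ x ix)) }
    where open Presented pr

  Presented⇒gammoid : ∀ {S} → (∀ x → S x) → Presented S → IsGammoid (VecMatroid M)
  Presented⇒gammoid all pr = Γ , id , id , T , λ I → mk⇔
    (λ ind → LinkedAt⇒Linked (mapLinked (λ _ → ⊤) (λ _ → ∈-subsetOf⁺ sinks?) (λ _ a → ⌊⌋-true (arcs? _ _) a , tt) (λ _ _ → tt)
      (complete (_∈? I) (λ x _ → all x) (LinIndep⇒Free M ind))))
    (λ lk → Free⇒LinIndep M (sound (_∈? I) (λ x _ → all x)
      (mapLinked (λ _ → ⊤) (λ _ → ∈-subsetOf⁻ sinks?) (λ _ a → true-⌊⌋ (arcs? _ _) a , tt) (λ _ _ → tt)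
        (Linked⇒LinkedAt lk))))
    where
    open Presented pr
    Γ : Digraph
    Γ = record { nW = N ; arc = λ u v → ⌊ arcs? u v ⌋ }
    T : Subset N
    T = subsetOf sinks?

  module Extend {S S′ : Fin N → Set} (w : Fin N) (pr : Presented S) (w∉S : ¬ S w)
                (S⊆S′ : ∀ x → S x → S′ x) (w∈S′ : S′ w) (S′⊆ : ∀ x → S′ x → S x ⊎ x ≡ w) where
    open Presented pr

    ∈S : ∀ {x} → S′ x → x ≢ w → S x
    ∈S {x} s′ x≢w = [ id , (λ eq → contradiction eq x≢w) ]′ (S′⊆ x s′)

    addColoop : (∀ Y → Cyc M Y → Y ⊑ S′ → Y w ≡ false) → Presented S′
    addColoop coloop = record { arcs = arcs ; arcs? = arcs? ; sinks = λ v → sinks v ⊎ v ≡ w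
      ; sinks? = λ v → sinks? v ⊎-dec (v ≟ w)
      ; arcs⊆ = λ a → let p , q = arcs⊆ a in S⊆S′ _ p , S⊆S′ _ q
      ; sinks⊆ = [ (λ t → S⊆S′ _ (sinks⊆ t)) , (λ { refl → w∈S′ }) ]′
      ; sound = sound′ ; complete = complete′ }
      where
      _−w : (Fin N → Set) → Fin N → Set
      (I −w) x = I x × x ≢ w
      −w? : ∀ {I} → (∀ x → Dec (I x)) → ∀ x → Dec ((I −w) x)
      −w? I? x = I? x ×-dec ¬? (x ≟ w)
      sound′ : ∀ {I} → (∀ x → Dec (I x)) → (∀ x → I x → S′ x) → LinkedAt arcs (λ v → sinks v ⊎ v ≡ w) id I → Free M I
      sound′ {I} I? I⊆ (P , disj) Z cZ Z⊑ = sound (−w? I?) (λ x (ix , x≢w) → ∈S (I⊆ x ix) x≢w) old Z cZ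
        λ j Zj → Z⊑ j Zj , λ { refl → true≢false Zj (coloop Z cZ λ x Zx → I⊆ x (Z⊑ x Zx)) }
        where
        old : LinkedAt arcs sinks id (I −w)
        old = mapLinked S (λ s → [ id , (λ { refl → contradiction s w∉S }) ]′) (λ _ a → a , proj₂ (arcs⊆ a))
          (λ x (ix , x≢w) → ∈S (I⊆ x ix) x≢w)
          ((λ x (ix , _) → P x ix) , λ (ix , _) (iy , _) → disj ix iy)
      complete′ : ∀ {I} → (∀ x → Dec (I x)) → (∀ x → I x → S′ x) → Free M I → LinkedAt arcs (λ v → sinks v ⊎ v ≡ w) id I
      complete′ {I} I? I⊆ free = P′ , λ {x} {y} → disj′ x y
        where
        old : LinkedAt arcs (λ v → sinks v ⊎ v ≡ w) id (I −w)
        old = mapLinked S (λ _ → inj₁) (λ _ a → a , proj₂ (arcs⊆ a)) (λ x (ix , x≢w) → ∈S (I⊆ x ix) x≢w)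
          (complete (−w? I?) (λ x (ix , x≢w) → ∈S (I⊆ x ix) x≢w) (Free-mono M (λ _ → proj₁) free))
        P′ : ∀ x → I x → Path arcs (λ v → sinks v ⊎ v ≡ w) x
        P′ x ix with x ≟ w
        ... | yes eq  = stop (inj₂ eq)
        ... | no x≢w = proj₁ old x (ix , x≢w)
        avoid : ∀ {x z} i → z on proj₁ old x i → z ≢ w
        avoid {x} (ix , x≢w) o refl = w∉S (on⇒closed (λ _ a → proj₂ (arcs⊆ a)) (∈S (I⊆ x ix) x≢w) (proj₁ old x (ix , x≢w)) o)
        disj′ : ∀ x y ix iy → x ≢ y → ∀ {z} → z on P′ x ix → z on P′ y iy → ⊥
        disj′ x y ix iy x≢y o o′ with x ≟ w | y ≟ w
        disj′ x y ix iy x≢y o    o′   | yes p  | yes q  = x≢y (trans p (sym q))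
        disj′ x y ix iy x≢y here o′   | yes p  | no q   = avoid _ o′ p
        disj′ x y ix iy x≢y o    here | no p   | yes q  = avoid _ o q
        disj′ x y ix iy x≢y o    o′   | no p   | no q   = proj₂ old (ix , p) (iy , q) x≢y o o′

    -- The arcs w → d make w a free point of the flat spanned by D − w.
    addFree : ∀ D → Cyc M D → D ∋ w → D ⊑ S′ →
              (∀ Y → Cyc M Y → Y ⊑ S → ∀ d → D ∋ d → Y ∋ d →
                ∃[ Y′ ] Cyc M Y′ × Y′ ⊑ (Y ∋_) × Y′ ∋ d × (∀ x → Y′ ∋ x → D ∋ x → x ≡ d)) →
              Presented S′
    addFree D cD Dw D⊑ isolate = record { arcs = arcs′
      ; arcs? = λ u v → arcs? u v ⊎-dec ((u ≟ w) ×-dec ((D v Bool.≟ true) ×-dec ¬? (v ≟ w)))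
      ; sinks = sinks ; sinks? = sinks?
      ; arcs⊆ = [ (λ a → let p , q = arcs⊆ a in S⊆S′ _ p , S⊆S′ _ q) , (λ { (refl , Dv , _) → w∈S′ , D⊑ _ Dv }) ]′
      ; sinks⊆ = λ t → S⊆S′ _ (sinks⊆ t)
      ; sound = sound′ ; complete = complete′ }
      where
      arcs′ : Fin N → Fin N → Set
      arcs′ u v = arcs u v ⊎ (u ≡ w × D ∋ v × v ≢ w)
      Replace : (Fin N → Set) → Fin N → Fin N → Set
      Replace I d x = (I x × x ≢ w) ⊎ x ≡ d
      Replace? : ∀ {I} → (∀ x → Dec (I x)) → ∀ d x → Dec (Replace I d x)
      Replace? I? d x = (I? x ×-dec ¬? (x ≟ w)) ⊎-dec (x ≟ d)
      T⇒ : ∀ {v} → S v → sinks v → sinks v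
      T⇒ _ t = t
      arc⇒ : ∀ {u v} → S u → arcs′ u v → arcs u v × S v
      arc⇒ s (inj₁ a)          = a , proj₂ (arcs⊆ a)
      arc⇒ s (inj₂ (refl , _)) = contradiction s w∉S
      sound′ : ∀ {I} → (∀ x → Dec (I x)) → (∀ x → I x → S′ x) → LinkedAt arcs′ sinks id I → Free M I
      sound′ {I} I? I⊆ (P , disj) with I? w
      ... | no w∉I = sound I? (λ x ix → ∈S (I⊆ x ix) λ { refl → w∉I ix })
            (mapLinked S T⇒ arc⇒ (λ x ix → ∈S (I⊆ x ix) λ { refl → w∉I ix }) (P , disj))
      ... | yes w∈I with P w w∈I | (λ {y} → disj {w} {y} w∈I)
      ...   | stop t | _ = contradiction (sinks⊆ t) w∉S
      ...   | step (inj₁ a) _ | _ = contradiction (proj₁ (arcs⊆ a)) w∉S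
      -- The path of `w` enters `S` at some d in D. Without its first vertex it links I - w + d
      -- inside `S`, so that set is independent.
      ...   | step {w = d} (inj₂ (_ , Dd , d≢w)) p | disj-w = goal
        where
        Sd : S d
        Sd = ∈S (D⊑ d Dd) d≢w
        d∉I : ¬ I d
        d∉I id′ = disj-w id′ (λ eq → d≢w (sym eq)) (there here) here
        ⊆S : ∀ x → Replace I d x → S x
        ⊆S x (inj₁ (ix , x≢w)) = ∈S (I⊆ x ix) x≢w
        ⊆S x (inj₂ refl)       = Sd
        P′ : ∀ x → Replace I d x → Path arcs′ sinks x
        P′ x (inj₁ (ix , _)) = P x ix
        P′ x (inj₂ refl)     = p
        disj′ : ∀ {x y} ix iy → x ≢ y → ∀ {z} → z on P′ x ix → z on P′ y iy → ⊥
        disj′ (inj₁ (ix , _)) (inj₁ (iy , _)) x≢y o o′ = disj ix iy x≢y o o′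
        disj′ (inj₁ (ix , x≢w)) (inj₂ refl) x≢y o o′   = disj-w ix (λ eq → x≢w (sym eq)) (there o′) o
        disj′ (inj₂ refl) (inj₁ (iy , y≢w)) x≢y o o′   = disj-w iy (λ eq → y≢w (sym eq)) (there o) o′
        disj′ (inj₂ refl) (inj₂ refl) x≢y o o′         = x≢y refl
        free : Free M (Replace I d)
        free = sound (Replace? I? d) ⊆S (mapLinked S T⇒ arc⇒ ⊆S (P′ , disj′))
        goal : Free M I
        goal Z cZ Z⊑ with true⊎false (Z w)
        ... | inj₂ Zw = free Z cZ λ j Zj → inj₁ (Z⊑ j Zj , λ { refl → true≢false Zj Zw })
        -- A cycle `Z` in I through w yields the cycle `Z ⊕ D` of earlier elements through d. Its
        -- part meeting `D` in d alone lies in I - w + d.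
        ... | inj₁ Zw with Y′ , cY′ , Y′⊑Y , Y′d , only ← isolate (Z ⊕ D) (Cyc-⊕ M cZ cD)
                (λ j p → ∈S ([ (λ Zj → I⊆ j (Z⊑ j Zj)) , D⊑ j ]′ (xor-true {Z j} p))
                   λ { refl → true≢false p (cong₂ _xor_ Zw Dw) })
                d Dd (cong₂ _xor_ (¬-not λ Zd → d∉I (Z⊑ d Zd)) Dd)
              = ⊥-elim (true≢false Y′d (free Y′ cY′ inside d))
          where
          inside : Y′ ⊑ Replace I d
          inside x Y′x with true⊎false (D x)
          ... | inj₁ Dx = inj₂ (only x Y′x Dx)
          ... | inj₂ Dx = inj₁ (Z⊑ x (trans (sym (xor-identityʳ (Z x))) (trans (cong (Z x xor_) (sym Dx)) (Y′⊑Y x Y′x))) ,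
                    λ { refl → true≢false Dw Dx })
      Candidate : (Fin N → Set) → Chain N → Set
      Candidate I Z = Cyc M Z × Z ∋ w × Z ⊑ (λ x → I x ⊎ D ∋ x)
      -- Among the cycles in I ∪ D through w take one, `Z`, minimal outside I; as I is independent,
      -- `Z` has an element d outside I. A cycle `f` in I - w + d through d would make `Z ⊕ f` a
      -- smaller choice: it still contains w and loses d, the only element of `f` outside I.
      exchange : ∀ {I} → (∀ x → Dec (I x)) → I w → Free M I → ∃[ d ] D ∋ d × ¬ I d × Free M (Replace I d)
      exchange {I} I? w∈I free with Z , (cZ , Zw , Z⊑) , least ← minimal {P = Candidate I}
          (λ f≗g (c , fw , f⊑) → Cyc-cong M f≗g c , trans (sym (f≗g w)) fw , λ j gj → f⊑ j (trans (f≗g j) gj))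
          (λ Z → Cyc? M Z ×-dec (Z w Bool.≟ true) ×-dec all? (λ j → (Z j Bool.≟ true) →-dec (I? j ⊎-dec (D j Bool.≟ true))))
          (λ x → ⌊ I? x ⌋) (D , cD , Dw , λ _ → inj₂)
        with any? (λ d → (Z d Bool.≟ true) ×-dec ¬? (I? d))
      ... | no ¬p = ⊥-elim (true≢false Zw (free Z cZ inI w))
        where
        inI : Z ⊑ I
        inI j Zj with I? j
        ... | yes ij = ij
        ... | no ¬ij = contradiction (j , Zj , ¬ij) ¬p
      ... | yes (d , Zd , d∉I) = d , Dd , d∉I , free′
        where
        K : Chain N
        K x = ⌊ I? x ⌋
        Dd : D ∋ d
        Dd = [ (λ i → contradiction i d∉I) , id ]′ (Z⊑ d Zd)
        free′ : Free M (Replace I d)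
        free′ f cf f⊑ with true⊎false (f d)
        ... | inj₂ fd = free f cf λ j fj → [ proj₁ , (λ { refl → ⊥-elim (true≢false fj fd) }) ]′ (f⊑ j fj)
        ... | inj₁ fd = ⊥-elim (true≢false
              (least (Z ⊕ f) (Cyc-⊕ M cZ cf , cong₂ _xor_ Zw (¬-not fw) , within) below d Kd Zd)
              (cong₂ _xor_ Zd fd))
          where
          fw : f w ≢ true
          fw p = [ (λ (_ , w≢w) → w≢w refl) , (λ { refl → d∉I w∈I }) ]′ (f⊑ w p)
          Kd : K d ≡ false
          Kd = ¬-not λ p → d∉I (true-⌊⌋ (I? d) p)
          within : Z ⊕ f ⊑ (λ x → I x ⊎ D ∋ x)
          within j p = [ Z⊑ j , (λ fj → [ (λ (ij , _) → inj₁ ij) , (λ { refl → inj₂ Dd }) ]′ (f⊑ j fj)) ]′ (xor-true {Z j} p)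
          below : Z ⊕ f ≼[ K ] Z
          below j Kj p = [ id , (λ fj → [ (λ (ij , _) → ⊥-elim (true≢false (⌊⌋-true (I? j) ij) Kj)) , (λ { refl → Zd }) ]′ (f⊑ j fj)) ]′
            (xor-true {Z j} p)
      complete′ : ∀ {I} → (∀ x → Dec (I x)) → (∀ x → I x → S′ x) → Free M I → LinkedAt arcs′ sinks id I
      complete′ {I} I? I⊆ free with I? w
      ... | no w∉I = mapLinked S T⇒ (λ _ a → inj₁ a , proj₂ (arcs⊆ a)) ⊆S (complete I? ⊆S free)
        where
        ⊆S : ∀ x → I x → S x
        ⊆S x ix = ∈S (I⊆ x ix) λ { refl → w∉I ix }
      ... | yes w∈I with d , Dd , d∉I , free′ ← exchange I? w∈I free = P′ , λ {x} {y} → disj′ x y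
        where
        d≢w : d ≢ w
        d≢w refl = d∉I w∈I
        ⊆S : ∀ x → Replace I d x → S x
        ⊆S x (inj₁ (ix , x≢w)) = ∈S (I⊆ x ix) x≢w
        ⊆S x (inj₂ refl)       = ∈S (D⊑ d Dd) d≢w
        old : LinkedAt arcs′ sinks id (Replace I d)
        old = mapLinked S T⇒ (λ _ a → inj₁ a , proj₂ (arcs⊆ a)) ⊆S (complete (Replace? I? d) ⊆S free′)
        P′ : ∀ x → I x → Path arcs′ sinks x
        P′ x ix with x ≟ w
        ... | yes refl = step (inj₂ (refl , Dd , d≢w)) (proj₁ old d (inj₂ refl))
        ... | no x≢w  = proj₁ old x (inj₁ (ix , x≢w))
        avoid : ∀ {x} i → ¬ (w on proj₁ old x i)
        avoid {x} i o = w∉S (on⇒closed (λ s a → proj₂ (arc⇒ s a)) (⊆S x i) (proj₁ old x i) o)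
        clash : ∀ {y} iy {y≢w : y ≢ w} {z} → z on step {v = w} (inj₂ (refl , Dd , d≢w)) (proj₁ old d (inj₂ refl)) →
                z on proj₁ old y (inj₁ (iy , y≢w)) → ⊥
        clash iy here      o′ = avoid _ o′
        clash iy {y≢w} (there o) o′ = proj₂ old (inj₂ refl) (inj₁ (iy , y≢w)) (λ { refl → d∉I iy }) o o′
        disj′ : ∀ x y ix iy → x ≢ y → ∀ {z} → z on P′ x ix → z on P′ y iy → ⊥
        disj′ x y ix iy x≢y o o′ with x ≟ w | y ≟ w
        ... | yes refl | yes refl = x≢y refl
        ... | yes refl | no q     = clash iy o o′
        ... | no p     | yes refl = clash ix o′ o
        ... | no p     | no q     = proj₂ old (inj₁ (ix , p)) (inj₁ (iy , q)) x≢y o o′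

-- The es-splitting of a matroid without G₈ minor

-- A minimal cycle `C` through `x` is a circuit: of a cycle `h` inside it and the difference
-- `C ⊕ h`, one contains `x` and must therefore be all of `C`.
circuitThrough : ∀ {r n} (A : Matrix r n) {Q : Fin n → Set} → (∀ j → Dec (Q j)) → ∀ {T x} →
                 Cyc A T → T ∋ x → T ⊑ Q → ∃[ C ] IsCircuit A C × C ∋ x × C ⊑ Q
circuitThrough {n = n} A {Q} Q? {T} {x} cT Tx T⊑ = go (minimal ext? dec? (λ _ → false) (T , cT , Tx , T⊑))
  where
  Candidate : Chain n → Set
  Candidate Z = Cyc A Z × Z ∋ x × Z ⊑ Q
  ext? : Ext Candidate
  ext? f≗g (c , fx , f⊑) = Cyc-cong A f≗g c , trans (sym (f≗g x)) fx , λ j gj → f⊑ j (trans (f≗g j) gj)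
  dec? : ∀ Z → Dec (Candidate Z)
  dec? Z = Cyc? A Z ×-dec (Z x Bool.≟ true) ×-dec all? (λ j → (Z j Bool.≟ true) →-dec Q? j)
  go : ∃ (IsMinimal Candidate (λ _ → false)) → ∃[ C ] IsCircuit A C × C ∋ x × C ⊑ Q
  go (C , (cC , Cx , C⊑) , least) = C , (cC , isCircuit) , Cx , C⊑
    where
    isCircuit : ∀ h → Cyc A h → h ⊑ (C ∋_) → Zero h ⊎ h ≗ C
    isCircuit h ch h⊑ with true⊎false (h x)
    ... | inj₁ hx = inj₂ λ j → agree j (true⊎false (C j))
      where
      agree : ∀ j → C ∋ j ⊎ C j ≡ false → h j ≡ C j
      agree j (inj₁ Cj) = trans (least h (ch , hx , λ j hj → C⊑ j (h⊑ j hj)) (λ j _ → h⊑ j) j refl Cj) (sym Cj)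
      agree j (inj₂ Cj) = trans (¬-not λ hj → true≢false (h⊑ j hj) Cj) (sym Cj)
    ... | inj₂ hx = inj₁ λ j → ¬-not λ hj → true≢false
          (least (C ⊕ h) (Cyc-⊕ A cC ch , cong₂ _xor_ Cx hx , λ j p → C⊑ j (below j refl p)) below j refl (h⊑ j hj))
          (cong₂ _xor_ (h⊑ j hj) hj)
      where
      below : C ⊕ h ≼[ (λ _ → false) ] C
      below j _ p = [ id , h⊑ j ]′ (xor-true {C j} p)

dot-zero : ∀ {n} {f : Chain n} r → (∀ j → f j ≡ false) → dot f r ≡ false
dot-zero r z = xorFin-false λ j → cong (_∧ r j) (z j)

equalColumns : ∀ {r n} (A : Matrix r n) {g i j} → Cyc A g → g ∋ i → g ∋ j → i ≢ j →
               (∀ x → g ∋ x → x ≡ i ⊎ x ≡ j) → ∀ k → A k i ≡ A k j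
equalColumns A {g} {i} {j} cg gi gj i≢j only k = xor≡false⇒≡ (begin
  A k i xor A k j                       ≡⟨ cong₂ _xor_ (dot-δ i (A k)) (dot-δ j (A k)) ⟨
  dot (δ i) (A k) xor dot (δ j) (A k)   ≡⟨ dot-⊕ (δ i) (δ j) (A k) ⟨
  dot (δ i ⊕ δ j) (A k)                 ≡⟨ dot-cong (A k) same ⟨
  dot g (A k)                           ≡⟨ cg k ⟩
  false                                 ∎)
  where
  open ≡-Reasoning
  same : g ≗ δ i ⊕ δ j
  same x with true⊎false (g x)
  ... | inj₁ gx with only x gx
  ...   | inj₁ refl = trans gx (sym (cong₂ _xor_ (δ-refl i) (δ-≢ (i≢j ∘ sym))))
  ...   | inj₂ refl = trans gx (sym (cong₂ _xor_ (δ-≢ i≢j) (δ-refl j)))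
  same x | inj₂ gx = trans gx (sym (cong₂ _xor_ (δ-≢ {i = i} {x} λ { refl → true≢false gi gx }) (δ-≢ {i = j} {x} λ { refl → true≢false gj gx })))

pattern q    = zero
pattern γ    = suc zero
pattern el j = suc (suc j)

module _ {r n} (A : Matrix r n) (X : Subset n) (e : Fin n) where

  M : Matrix (suc r) (suc (suc n))
  M = esSplit A X e

  -- Identifying γ with e turns a cycle of the es-splitting into a cycle of A;
  -- lift c is the section of this map with coefficient c at γ.
  merge : Chain (suc (suc n)) → Chain n
  merge f = (λ j → f (el j)) ⊕ λ j → f γ ∧ δ e j

  lift : Bool → Chain n → Chain (suc (suc n))
  lift c g q      = dot (g ⊕ λ j → c ∧ δ e j) (lookup X)
  lift c g γ      = c
  lift c g (el j) = g j xor (c ∧ δ e j)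

  dot-∧δ : ∀ c ρ → dot (λ j → c ∧ δ e j) ρ ≡ c ∧ ρ e
  dot-∧δ true  ρ = dot-δ e ρ
  dot-∧δ false ρ = dot-zero ρ λ _ → refl

  top-row : ∀ f → dot f (M zero) ≡ f q xor dot (λ j → f (el j)) (lookup X)
  top-row f = cong₂ _xor_ (∧-identityʳ (f q)) (cong (_xor dot (λ j → f (el j)) (lookup X)) (∧-zeroʳ (f γ)))

  other-row : ∀ f i → dot f (M (suc i)) ≡ dot (merge f) (A i)
  other-row f i = begin
    (f q ∧ false) xor ((f γ ∧ A i e) xor dot (λ j → f (el j)) (A i))
      ≡⟨ cong (_xor ((f γ ∧ A i e) xor dot (λ j → f (el j)) (A i))) (∧-zeroʳ (f q)) ⟩
    (f γ ∧ A i e) xor dot (λ j → f (el j)) (A i)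
      ≡⟨ xor-comm (f γ ∧ A i e) (dot (λ j → f (el j)) (A i)) ⟩
    dot (λ j → f (el j)) (A i) xor (f γ ∧ A i e)
      ≡⟨ cong (dot (λ j → f (el j)) (A i) xor_) (dot-∧δ (f γ) (A i)) ⟨
    dot (λ j → f (el j)) (A i) xor dot (λ j → f γ ∧ δ e j) (A i)
      ≡⟨ dot-⊕ (λ j → f (el j)) (λ j → f γ ∧ δ e j) (A i) ⟨
    dot (merge f) (A i) ∎
    where open ≡-Reasoning

  Cyc-merge : ∀ {f} → Cyc M f → Cyc A (merge f)
  Cyc-merge {f} cf i = trans (sym (other-row f i)) (cf (suc i))

  Cyc-q : ∀ {f} → Cyc M f → f q ≡ dot (λ j → f (el j)) (lookup X)
  Cyc-q {f} cf = xor≡false⇒≡ (trans (sym (top-row f)) (cf zero))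

  merge-lift : ∀ c g → merge (lift c g) ≗ g
  merge-lift c g j = begin
    (g j xor (c ∧ δ e j)) xor (c ∧ δ e j)  ≡⟨ xor-assoc (g j) (c ∧ δ e j) (c ∧ δ e j) ⟩
    g j xor ((c ∧ δ e j) xor (c ∧ δ e j))  ≡⟨ cong (g j xor_) (xor-same (c ∧ δ e j)) ⟩
    g j xor false                          ≡⟨ xor-identityʳ (g j) ⟩
    g j                                    ∎
    where open ≡-Reasoning

  Cyc-lift : ∀ c {g} → Cyc A g → Cyc M (lift c g)
  Cyc-lift c {g} cg zero    = trans (top-row (lift c g)) (xor-same (lift c g q))
  Cyc-lift c {g} cg (suc i) = trans (other-row (lift c g) i) (trans (dot-cong (A i) (merge-lift c g)) (cg i))

  ∧δ-≢ : ∀ c {j} → j ≢ e → c ∧ δ e j ≡ false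
  ∧δ-≢ c j≢e = trans (cong (c ∧_) (δ-≢ (j≢e ∘ sym))) (∧-zeroʳ c)

  xor-∧δ-≢ : ∀ a c {j} → j ≢ e → a xor (c ∧ δ e j) ≡ a
  xor-∧δ-≢ a c j≢e = trans (cong (a xor_) (∧δ-≢ c j≢e)) (xor-identityʳ a)

  xor-∧δ-e : ∀ a c → a xor (c ∧ δ e e) ≡ a xor c
  xor-∧δ-e a c = cong (a xor_) (trans (cong (c ∧_) (δ-refl e)) (∧-identityʳ c))

  xor-∧δ-true : ∀ a c {j} → a xor (c ∧ δ e j) ≡ true → a ≡ true ⊎ j ≡ e
  xor-∧δ-true a c {j} p = [ inj₁ , (λ s → inj₂ (sym (δ⇒≡ (proj₂ (∧-true {c} s))))) ]′ (xor-true {a} p)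

  -- e comes before the elements of its circuit: were it added after them, neither its circuit nor {e, γ, q}
  -- would satisfy the hypothesis of addFree when the circuit through γ has a lift containing q.
  Initial : ℕ → Fin (suc (suc n)) → Set
  Initial k q      = ⊤
  Initial k γ      = ⊤
  Initial k (el j) = j ≡ e ⊎ toℕ j < k

  Initial? : ∀ k x → Dec (Initial k x)
  Initial? k q      = yes tt
  Initial? k γ      = yes tt
  Initial? k (el j) = (j ≟ e) ⊎-dec (toℕ j ℕ.<? k)

  module _ (Xe : lookup X ∋ e) where

    start-q : Presented M (_≡ q)
    start-q = Extend.addColoop M q (Presented-∅ M) (λ ()) (λ _ ()) refl (λ _ → inj₂)
      λ Y cY Y⊑ → trans (Cyc-q {Y} cY) (dot-zero (lookup X) λ j → ¬-not λ p → case (Y⊑ (el j) p))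
      where
      case : ∀ {j : Fin n} → _≢_ {A = Fin (suc (suc n))} (el j) q
      case ()

    -- Below the new row `γ` copies the column of `e`. If `e` is a loop of `A`, so is `γ`, and D =
    -- {γ} gives it no arcs; otherwise `γ` is independent of `q`.
    start-γ : Presented M (λ x → x ≡ q ⊎ x ≡ γ)
    start-γ with Cyc? A (δ e)
    ... | yes loop = addFree (δ γ) cyc refl (λ x p → inj₂ (sym (δ⇒≡ p)))
            λ Y cY Y⊑ d Dd Yd → ⊥-elim (γ≢q (trans (δ⇒≡ Dd) (Y⊑ d Yd)))
      where
      γ≢q : _≢_ {A = Fin (suc (suc n))} γ q
      γ≢q ()
      open Extend M γ start-q γ≢q (λ _ → inj₁) (inj₂ refl) (λ _ → id)
      cyc : Cyc M (δ γ)
      cyc zero    = dot-δ γ (M zero)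
      cyc (suc i) = trans (dot-δ γ (M (suc i))) (trans (sym (dot-δ e (A i))) (loop i))
    ... | no ¬loop = Extend.addColoop M γ start-q (λ ()) (λ _ → inj₁) (inj₂ refl) (λ _ → id)
            λ Y cY Y⊑ → ¬-not λ Yγ → ¬loop (Cyc-cong A (only Y Y⊑ Yγ) (Cyc-merge {Y} cY))
      where
      only : ∀ Y → Y ⊑ (λ x → x ≡ q ⊎ x ≡ γ) → Y ∋ γ → merge Y ≗ δ e
      only Y Y⊑ Yγ j = cong₂ (λ a b → a xor (b ∧ δ e j)) (¬-not λ p → case (Y⊑ (el j) p)) Yγ
        where
        case : ¬ (el j ≡ q ⊎ el j ≡ γ)
        case (inj₁ ())
        case (inj₂ ())

    -- If the cycle shares no element but `s` with `D`, it needs no cutting down.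
    isolated : ∀ {D Y} s → (∀ z → D ∋ z → Y ∋ z → z ≡ s) → Cyc M Y → ∀ d → D ∋ d → Y ∋ d →
               ∃[ Y′ ] Cyc M Y′ × Y′ ⊑ (Y ∋_) × Y′ ∋ d × (∀ x → Y′ ∋ x → D ∋ x → x ≡ d)
    isolated {D} {Y} s meet cY d Dd Yd =
      Y , cY , (λ _ → id) , Yd , λ x Yx Dx → trans (meet x Dx Yx) (sym (meet d Dd Yd))

    -- Since `e` is in `X`, its column is the sum of those of `q` and `γ`, so D = {q, γ, e}. Earlier
    -- cycles lie in {q, γ} and avoid `q`, whose entry in the top row nothing could cancel.
    start-e : Presented M (Initial 0)
    start-e = Extend.addFree M (el e) start-γ (λ { (inj₁ ()) ; (inj₂ ()) })
      (λ { _ (inj₁ refl) → tt ; _ (inj₂ refl) → tt }) (inj₁ refl)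
      (λ { q _ → inj₁ (inj₁ refl) ; γ _ → inj₁ (inj₂ refl) ; (el j) (inj₁ refl) → inj₂ refl })
      (lift true (λ _ → false)) (Cyc-lift true λ i → dot-zero (A i) λ _ → refl)
      (δ-refl e) (λ { q _ → tt ; γ _ → tt ; (el j) p → inj₁ (sym (δ⇒≡ p)) })
      λ Y cY Y⊑ → isolated γ (meet Y cY Y⊑) cY
      where
      meet : ∀ Y → Cyc M Y → Y ⊑ (λ x → x ≡ q ⊎ x ≡ γ) → ∀ z → lift true (λ _ → false) ∋ z → Y ∋ z → z ≡ γ
      meet Y cY Y⊑ z _ Yz with Y⊑ z Yz
      ... | inj₂ z≡γ  = z≡γ
      ... | inj₁ refl = ⊥-elim (true≢false Yz (trans (Cyc-q {Y} cY)
              (dot-zero (lookup X) λ j → ¬-not λ p → case (Y⊑ (el j) p))))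
        where
        case : ∀ {j : Fin n} → ¬ (_≡_ {A = Fin (suc (suc n))} (el j) q ⊎ el j ≡ γ)
        case (inj₁ ())
        case (inj₂ ())

    module _ (no-crossing : ∀ {C x y z T u v} → IsCircuit A C → x ≢ y → y ≢ z → x ≢ z → C ∋ x → C ∋ y → C ∋ z →
                            Cyc A T → C ∋ u → T ∋ u → C ∋ v → T v ≡ false → ⊥) where

      module Add (j : Fin n) (j≢e : j ≢ e) (pr : Presented M (Initial (toℕ j))) where

        Old New : Fin (suc (suc n)) → Set
        Old = Initial (toℕ j)
        New = Initial (suc (toℕ j))

        j∉Old : ¬ Old (el j)
        j∉Old (inj₁ eq)  = j≢e eq
        j∉Old (inj₂ j<j) = ℕ.<-irrefl refl j<j

        Old⊆New : ∀ x → Old x → New x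
        Old⊆New q      _         = tt
        Old⊆New γ      _         = tt
        Old⊆New (el i) (inj₁ eq) = inj₁ eq
        Old⊆New (el i) (inj₂ lt) = inj₂ (ℕ.m<n⇒m<1+n lt)

        New⊆ : ∀ x → New x → Old x ⊎ x ≡ el j
        New⊆ q      _         = inj₁ tt
        New⊆ γ      _         = inj₁ tt
        New⊆ (el i) (inj₁ eq) = inj₁ (inj₁ eq)
        New⊆ (el i) (inj₂ (s≤s le)) with ℕ.m≤n⇒m<n∨m≡n le
        ... | inj₁ lt = inj₁ (inj₂ lt)
        ... | inj₂ eq = inj₂ (cong (λ z → el z) (toℕ-injective eq))

        open Extend M (el j) pr j∉Old Old⊆New (inj₂ (ℕ.n<1+n (toℕ j))) New⊆

        Y∌j : ∀ {Y} → Y ⊑ Old → Y (el j) ≡ false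
        Y∌j Y⊑ = ¬-not λ p → j∉Old (Y⊑ (el j) p)

        merge∌j : ∀ {Y} → Y ⊑ Old → merge Y j ≡ false
        merge∌j {Y} Y⊑ = trans (xor-∧δ-≢ (Y (el j)) (Y γ) j≢e) (Y∌j Y⊑)

        addUnspanned : ¬ (∃[ g ] Cyc A g × g ∋ j × g ⊑ (λ i → New (el i))) → Presented M New
        addUnspanned none = addColoop λ Y cY Y⊑ → ¬-not λ Yj → none
          (merge Y , Cyc-merge {Y} cY , trans (xor-∧δ-≢ (Y (el j)) (Y γ) j≢e) Yj ,
            λ i p → [ Y⊑ (el i) , inj₁ ]′ (xor-∧δ-true (Y (el i)) (Y γ) p))

        module Dependent {g} (circ : IsCircuit A g) (gj : g ∋ j) (g⊑ : g ⊑ (λ i → New (el i))) where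

          lift∋j : ∀ c → lift c g ∋ el j
          lift∋j c = trans (xor-∧δ-≢ (g j) c j≢e) gj

          lift⊑ : ∀ c → lift c g ⊑ New
          lift⊑ c q      _ = tt
          lift⊑ c γ      _ = tt
          lift⊑ c (el i) p = [ g⊑ i , inj₁ ]′ (xor-∧δ-true (g i) c p)

          addLift : ∀ c s → (∀ Y → Cyc M Y → Y ⊑ Old → ∀ z → lift c g ∋ z → Y ∋ z → z ≡ s) → Presented M New
          addLift c s meet = addFree (lift c g) (Cyc-lift c (proj₁ circ)) (lift∋j c) (lift⊑ c)
            λ Y cY Y⊑ → isolated s (meet Y cY Y⊑) cY

          lift-false : ∀ {y} → lift false g ∋ el y → g ∋ y
          lift-false {y} p = trans (sym (xor-identityʳ (g y))) p

          -- The lift is {j}, or {q, j} if j is in `X`, so only `q` can be shared with an earlier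
          -- cycle.
          addLoop : (∀ i → g ∋ i → i ≡ j) → Presented M New
          addLoop only = addLift false q meet
            where
            meet : ∀ Y → Cyc M Y → Y ⊑ Old → ∀ z → lift false g ∋ z → Y ∋ z → z ≡ q
            meet Y cY Y⊑ q      _ _ = refl
            meet Y cY Y⊑ (el y) p Yy with refl ← only y (lift-false p) = ⊥-elim (true≢false Yy (Y∌j {Y} Y⊑))

          -- With three elements in `g`, the merge of an earlier cycle, which misses `j`, must be
          -- disjoint from `g`. If `e` is not in `g`, only `q` can be shared. If it is, an earlier
          -- cycle may still contain `e` and `γ` together, as they cancel in the merge; so the lift
          -- has to contain just one of them and to avoid `q`.
          addLong : ∀ {i k} → g ∋ i → g ∋ k → i ≢ j → k ≢ i → k ≢ j → Presented M New
          addLong {i} {k} gi gk i≢j k≢i k≢j with true⊎false (g e)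
          ... | inj₂ ge = addLift false q meet
            where
            meet : ∀ Y → Cyc M Y → Y ⊑ Old → ∀ z → lift false g ∋ z → Y ∋ z → z ≡ q
            meet Y cY Y⊑ q      _ _ = refl
            meet Y cY Y⊑ (el y) p Yy = ⊥-elim (no-crossing circ i≢j (k≢j ∘ sym) (k≢i ∘ sym) gi gj gk (Cyc-merge {Y} cY)
              (lift-false p) (trans (xor-∧δ-≢ (Y (el y)) (Y γ) λ { refl → true≢false (lift-false p) ge }) Yy)
              gj (merge∌j {Y} Y⊑))
          -- The coefficient at γ makes the lift avoid q.
          ... | inj₁ ge = addLift c s meet
            where
            c = dot g (lookup X)
            s : Fin (suc (suc n))
            s = if c then γ else el e
            lift-q : lift c g q ≡ false
            lift-q = begin
              dot (g ⊕ λ y → c ∧ δ e y) (lookup X)              ≡⟨ dot-⊕ g (λ y → c ∧ δ e y) (lookup X) ⟩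
              c xor dot (λ y → c ∧ δ e y) (lookup X)            ≡⟨ cong (c xor_) (dot-∧δ c (lookup X)) ⟩
              c xor (c ∧ lookup X e)                            ≡⟨ cong (λ z → c xor (c ∧ z)) Xe ⟩
              c xor (c ∧ true)                                  ≡⟨ cong (c xor_) (∧-identityʳ c) ⟩
              c xor c                                           ≡⟨ xor-same c ⟩
              false                                             ∎
              where open ≡-Reasoning
            meet : ∀ Y → Cyc M Y → Y ⊑ Old → ∀ z → lift c g ∋ z → Y ∋ z → z ≡ s
            meet Y cY Y⊑ q      p _ = ⊥-elim (true≢false p lift-q)
            meet Y cY Y⊑ γ      p _ = sym (cong (λ b → if b then γ else el e) p)
            meet Y cY Y⊑ (el y) p Yy with y ≟ e
            ... | yes refl = sym (cong (λ b → if b then γ else el e)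
                    (¬-not λ ct → true≢false p (trans (xor-∧δ-e (g e) c) (cong₂ _xor_ ge ct))))
            ... | no y≢e  = ⊥-elim (no-crossing circ i≢j (k≢j ∘ sym) (k≢i ∘ sym) gi gj gk (Cyc-merge {Y} cY)
                    (trans (sym (xor-∧δ-≢ (g y) c y≢e)) p) (trans (xor-∧δ-≢ (Y (el y)) (Y γ) y≢e) Yy)
                    gj (merge∌j {Y} Y⊑))

          module Parallel {i} (gi : g ∋ i) (i≢j : i ≢ j) (only : ∀ x → g ∋ x → x ≡ i ⊎ x ≡ j) where

            i∥j : ∀ k → A k i ≡ A k j
            i∥j = equalColumns A (proj₁ circ) gi gj i≢j only

            addParallelTo : ∀ s → Old s → (∀ k → M k s ≡ M k (el j)) → Presented M New
            addParallelTo s s∈ same = addFree (δ s ⊕ δ (el j)) (Cyc-pair M same)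
              (cong₂ _xor_ (δ-≢ s≢j) (δ-refl (el j)))
              (λ x p → [ (λ q′ → subst New (δ⇒≡ q′) (Old⊆New s s∈)) , (λ q′ → subst New (δ⇒≡ q′) (inj₂ (ℕ.n<1+n (toℕ j)))) ]′
                (xor-true {δ s x} p))
              λ Y cY Y⊑ → isolated s (λ z p Yz → [ sym ∘ δ⇒≡ , (λ q′ → contradiction (subst Old (sym (δ⇒≡ q′)) (Y⊑ z Yz)) j∉Old) ]′
                (xor-true {δ s z} p)) cY
              where
              s≢j : s ≢ el j
              s≢j refl = j∉Old s∈

            module Opposite (differs : ∀ s → Old s → ¬ (∀ k → M k s ≡ M k (el j))) where

              i∈ : Old (el i)
              i∈ = [ id , (λ { refl → contradiction refl i≢j }) ]′ (New⊆ (el i) (g⊑ i gi))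

              opposite : ∀ {s} → Old s → (∀ k → M (suc k) s ≡ A k i) → M zero s ≢ lookup X j
              opposite s∈ same eq = differs _ s∈ λ { zero → eq ; (suc k) → trans (same k) (i∥j k) }

              -- `e` and `γ` carry the same column of `A` under the top entries 1 and 0, so any
              -- element parallel to `e` has the full column of one of them.
              i≢e : i ≢ e
              i≢e refl with true⊎false (lookup X j)
              ... | inj₁ Xj = opposite i∈ (λ _ → refl) (trans Xe (sym Xj))
              ... | inj₂ Xj = opposite {γ} tt (λ _ → refl) (sym Xj)

              -- Both top entries differ from that of `j`, and there are only two values.
              agree : ∀ {s} → Old s → (∀ k → M (suc k) s ≡ A k i) → ∀ k → M k s ≡ M k (el i)
              agree s∈ same (suc k) = same k
              agree s∈ same zero    = two-valued (opposite s∈ same) (opposite i∈ λ _ → refl)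
                where
                two-valued : ∀ {a b c : Bool} → a ≢ c → b ≢ c → a ≡ b
                two-valued p p′ = trans (¬-not p) (sym (¬-not p′))

              -- Take a circuit `C` through `i` inside the merge of `Y`. It is not {i}, since then
              -- `j` would be a loop inside the circuit {i, j}. It has no third element, since {i,
              -- j} would cross it, as `j` is not in `C`. So `C` is {i, k} with `k` parallel to `i`,
              -- and `k` comes from an element of `Y`, which may be `γ` if `k` is `e`.
              partner : ∀ {Y} → Cyc M Y → Y ⊑ Old → Y ∋ el i →
                        ∃[ t ] Y ∋ t × t ≢ el i × t ≢ q × (∀ k → M k t ≡ M k (el i))
              partner {Y} cY Y⊑ Yi
                with C , Ccirc , Ci , C⊑ ← circuitThrough A (λ x → merge Y x Bool.≟ true) (Cyc-merge {Y} cY)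
                       (trans (xor-∧δ-≢ (Y (el i)) (Y γ) i≢e) Yi) (λ _ → id)
                with any? (λ k → (C k Bool.≟ true) ×-dec ¬? (k ≟ i))
              ... | no ¬k = ⊥-elim ([ (λ z → true≢false (δ-refl j) (z j))
                                     , (λ z → true≢false gi (trans (sym (z i)) (δ-≢ (i≢j ∘ sym)))) ]′
                      (proj₂ circ (δ j) loop λ x p → subst (g ∋_) (δ⇒≡ p) gj))
                where
                C≗δ : C ≗ δ i
                C≗δ x with x ≟ i
                ... | yes refl = trans Ci (sym (δ-refl i))
                ... | no x≢i  = trans (¬-not λ Cx → ¬k (x , Cx , x≢i)) (sym (δ-≢ (x≢i ∘ sym)))
                loop : Cyc A (δ j)
                loop k = begin
                  dot (δ j) (A k)  ≡⟨ dot-δ j (A k) ⟩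
                  A k j            ≡⟨ i∥j k ⟨
                  A k i            ≡⟨ dot-δ i (A k) ⟨
                  dot (δ i) (A k)  ≡⟨ dot-cong (A k) C≗δ ⟨
                  dot C (A k)      ≡⟨ proj₁ Ccirc k ⟩
                  false            ∎
                  where open ≡-Reasoning
              ... | yes (k , Ck , k≢i) with any? (λ x → (C x Bool.≟ true) ×-dec (¬? (x ≟ i) ×-dec ¬? (x ≟ k)))
              ...   | yes (x , Cx , x≢i , x≢k) = ⊥-elim (no-crossing Ccirc (k≢i ∘ sym) (x≢k ∘ sym) (x≢i ∘ sym) Ci Ck Cx
                      (proj₁ circ) Ci gi Ck (¬-not λ gk → [ k≢i , (λ { refl → true≢false (C⊑ k Ck) (merge∌j {Y} Y⊑) }) ]′ (only k gk)))
              ...   | no ¬x = choose (k ≟ e)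
                where
                i∥k : ∀ r′ → A r′ k ≡ A r′ i
                i∥k = equalColumns A (proj₁ Ccirc) Ck Ci k≢i pair
                  where
                  pair : ∀ x → C ∋ x → x ≡ k ⊎ x ≡ i
                  pair x Cx with x ≟ k | x ≟ i
                  ... | yes p | _     = inj₁ p
                  ... | no _  | yes p = inj₂ p
                  ... | no p  | no p′ = contradiction (x , Cx , p′ , p) ¬x
                el-injective : ∀ {a b : Fin n} → el a ≡ el b → a ≡ b
                el-injective refl = refl
                choose : Dec (k ≡ e) → ∃[ t ] Y ∋ t × t ≢ el i × t ≢ q × (∀ k → M k t ≡ M k (el i))
                choose (no k≢e) = el k , Yk , (λ p → k≢i (el-injective p)) , (λ ()) , agree (Y⊑ _ Yk) i∥k
                  where
                  Yk : Y ∋ el k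
                  Yk = trans (sym (xor-∧δ-≢ (Y (el k)) (Y γ) k≢e)) (C⊑ k Ck)
                choose (yes refl) with xor-true {Y (el e)} (C⊑ e Ck)
                ... | inj₁ Ye = el e , Ye , (λ p → k≢i (el-injective p)) , (λ ()) , agree (Y⊑ _ Ye) i∥k
                ... | inj₂ p  = γ , proj₁ (∧-true {Y γ} p) , (λ ()) , (λ ()) , agree {γ} tt i∥k

              -- Here D = {q, i, j}. An earlier cycle `Y` through `i` also contains its `partner`
              -- `t`, and splits into {t, i}, which meets `D` in `i` alone, and a remainder that
              -- meets it in `q` at most.
              addOpposite : Presented M New
              addOpposite = addFree D (Cyc-lift false (proj₁ circ)) (lift∋j false) (lift⊑ false) isolate
                where
                D = lift false g
                meet : ∀ {Y} → Y ⊑ Old → ∀ z → D ∋ z → Y ∋ z → z ≡ q ⊎ z ≡ el i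
                meet Y⊑ q      _ _ = inj₁ refl
                meet {Y} Y⊑ (el y) p Yy with only y (lift-false p)
                ... | inj₁ refl = inj₂ refl
                ... | inj₂ refl = ⊥-elim (true≢false Yy (Y∌j {Y} Y⊑))
                isolate : ∀ Y → Cyc M Y → Y ⊑ Old → ∀ d → D ∋ d → Y ∋ d →
                  ∃[ Y′ ] Cyc M Y′ × Y′ ⊑ (Y ∋_) × Y′ ∋ d × (∀ x → Y′ ∋ x → D ∋ x → x ≡ d)
                isolate Y cY Y⊑ d Dd Yd with true⊎false (Y (el i))
                ... | inj₂ Yi = isolated q (λ z Dz Yz → [ id , (λ { refl → ⊥-elim (true≢false Yz Yi) }) ]′ (meet {Y} Y⊑ z Dz Yz)) cY d Dd Yd
                ... | inj₁ Yi with t , Yt , t≢i , t≢q , same ← partner {Y} cY Y⊑ Yi | meet {Y} Y⊑ d Dd Yd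
                ...   | inj₂ refl = Y₂ , Cyc-pair M same , Y₂⊑ , cong₂ _xor_ (δ-≢ t≢i) (δ-refl (el i)) ,
                        λ x Y₂x Dx → [ (λ { refl → contradiction (Y₂x) Y₂∌q }) , id ]′ (meet {Y} Y⊑ x Dx (Y₂⊑ x Y₂x))
                  where
                  Y₂ = δ t ⊕ δ (el i)
                  Y₂⊑ : Y₂ ⊑ (Y ∋_)
                  Y₂⊑ x p = [ (λ p′ → subst (Y ∋_) (δ⇒≡ p′) Yt) , (λ p′ → subst (Y ∋_) (δ⇒≡ p′) Yi) ]′ (xor-true {δ t x} p)
                  Y₂∌q : ¬ (Y₂ ∋ q)
                  Y₂∌q p = true≢false p (cong₂ _xor_ (δ-≢ t≢q) refl)
                ...   | inj₁ refl = Y ⊕ Y₂ , Cyc-⊕ M {Y} {Y₂} cY (Cyc-pair M same) , Y⊕Y₂⊑ ,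
                        cong₂ _xor_ Yd (cong₂ _xor_ (δ-≢ t≢q) refl) ,
                        λ x p Dx → [ id , (λ { refl → ⊥-elim (true≢false p
                          (cong₂ _xor_ Yi (cong₂ _xor_ (δ-≢ t≢i) (δ-refl (el i))))) }) ]′ (meet {Y} Y⊑ x Dx (Y⊕Y₂⊑ x p))
                  where
                  Y₂ = δ t ⊕ δ (el i)
                  Y₂⊑ : Y₂ ⊑ (Y ∋_)
                  Y₂⊑ x p = [ (λ p′ → subst (Y ∋_) (δ⇒≡ p′) Yt) , (λ p′ → subst (Y ∋_) (δ⇒≡ p′) Yi) ]′ (xor-true {δ t x} p)
                  Y⊕Y₂⊑ : Y ⊕ Y₂ ⊑ (Y ∋_)
                  Y⊕Y₂⊑ x p = [ id , Y₂⊑ x ]′ (xor-true {Y x} p)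

            addPair : Presented M New
            addPair with any? (λ s → Initial? (toℕ j) s ×-dec all? (λ k → M k s Bool.≟ M k (el j)))
            ... | yes (s , s∈ , same) = addParallelTo s s∈ same
            ... | no ¬s               = Opposite.addOpposite λ s s∈ same → ¬s (s , s∈ , same)

          add : Presented M New
          add with any? (λ i → (g i Bool.≟ true) ×-dec ¬? (i ≟ j))
          ... | no ¬i = addLoop only
            where
            only : ∀ i → g ∋ i → i ≡ j
            only i gi with i ≟ j
            ... | yes p = p
            ... | no p  = contradiction (i , gi , p) ¬i
          ... | yes (i , gi , i≢j) with any? (λ k → (g k Bool.≟ true) ×-dec (¬? (k ≟ i) ×-dec ¬? (k ≟ j)))
          ...   | yes (k , gk , k≢i , k≢j) = addLong gi gk i≢j k≢i k≢j
          ...   | no ¬k = Parallel.addPair gi i≢j only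
            where
            only : ∀ x → g ∋ x → x ≡ i ⊎ x ≡ j
            only x gx with x ≟ i | x ≟ j
            ... | yes p | _     = inj₁ p
            ... | no _  | yes p = inj₂ p
            ... | no p  | no p′ = contradiction (x , gx , p , p′) ¬k

        addElement : Presented M New
        addElement with anyChain? {P = λ g → Cyc A g × g ∋ j × g ⊑ (λ i → New (el i))}
            (λ f≗g (c , fj , f⊑) → Cyc-cong A f≗g c , trans (sym (f≗g j)) fj , λ i gi → f⊑ i (trans (f≗g i) gi))
            (λ g → Cyc? A g ×-dec (g j Bool.≟ true) ×-dec all? (λ i → (g i Bool.≟ true) →-dec Initial? (suc (toℕ j)) (el i)))
        ... | no none = addUnspanned none
        ... | yes (T , cT , Tj , T⊑) with g , circ , gj , g⊑ ← circuitThrough A (λ i → Initial? (suc (toℕ j)) (el i)) cT Tj T⊑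
              = Dependent.add circ gj g⊑

      presented : ∀ k → k ≤ n → Presented M (Initial k)
      presented zero    _   = start-e
      presented (suc k) k<n = subst (λ z → Presented M (Initial (suc z))) (toℕ-fromℕ< k<n)
        (next′ (fromℕ< k<n) (subst (λ z → Presented M (Initial z)) (sym (toℕ-fromℕ< k<n)) (presented k (ℕ.<⇒≤ k<n))))
        where
        next′ : ∀ j → Presented M (Initial (toℕ j)) → Presented M (Initial (suc (toℕ j)))
        next′ j pr with j ≟ e
        ... | no j≢e = Add.addElement j j≢e pr
        -- `e` belongs to every `Initial k`, so its own turn adds nothing.
        ... | yes refl = Presented-resp M
              (λ { q _ → tt ; γ _ → tt ; (el i) (inj₁ p) → inj₁ p ; (el i) (inj₂ p) → inj₂ (ℕ.m<n⇒m<1+n p) })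
              (λ { q _ → tt ; γ _ → tt ; (el i) (inj₁ p) → inj₁ p ; (el i) (inj₂ (s≤s p)) → shrink i (ℕ.m≤n⇒m<n∨m≡n p) }) pr
          where
          shrink : ∀ i → toℕ i < toℕ j ⊎ toℕ i ≡ toℕ j → i ≡ j ⊎ toℕ i < toℕ j
          shrink i (inj₁ p) = inj₂ p
          shrink i (inj₂ p) = inj₁ (toℕ-injective p)

      esSplit-gammoid : IsGammoid (VecMatroid M)
      esSplit-gammoid = Presented⇒gammoid M
        (λ { q → tt ; γ → tt ; (el i) → inj₂ (toℕ<n i) }) (presented n ℕ.≤-refl)

-- Base orderability of gammoids

iterate : ∀ {A : Set} → (A → A) → ℕ → A → A
iterate f zero    x = x
iterate f (suc k) x = f (iterate f k x)

iterate-cancel : ∀ {A : Set} {f : A → A} → Injective _≡_ _≡_ f → ∀ i d {x y} →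
                 iterate f i x ≡ iterate f (i + d) y → x ≡ iterate f d y
iterate-cancel inj zero    d eq = eq
iterate-cancel inj (suc i) d eq = iterate-cancel inj i d (inj eq)

inj₁≢inj₂ : ∀ {A B : Set} {a : A} {b : B} {c : A ⊎ B} → c ≡ inj₁ a → c ≡ inj₂ b → ⊥
inj₁≢inj₂ refl ()

_[_≔_] : ∀ {ℓ} {A : Set} → (Fin ℓ → A) → Fin ℓ → A → Fin ℓ → A
(a [ l ≔ x ]) l′ with l′ ≟ l
... | yes _ = x
... | no _  = a l′

module _ {w ℓ : ℕ} where

  Node : Set
  Node = Fin w ⊎ Fin ℓ

  module Orbits {f : Node → Node} (f-inj : Injective _≡_ _≡_ f) where

    abstract
      periodic : ∀ x → ∃[ p ] iterate f (suc p) x ≡ x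
      periodic x with i , j , i<j , eq ← pigeonhole (ℕ.n<1+n (w + ℓ)) (λ i → join w ℓ (iterate f (toℕ i) x))
        with d , refl′ ← ℕ.m≤n⇒∃[o]m+o≡n i<j =
        d , sym (iterate-cancel f-inj (toℕ i) (suc d) (trans (join-injective eq)
              (cong (λ k → iterate f k x) (trans (sym refl′) (sym (ℕ.+-suc (toℕ i) d))))))
        where
        join-injective : ∀ {x y} → join w ℓ x ≡ join w ℓ y → x ≡ y
        join-injective {x} {y} eq = trans (sym (splitAt-join w ℓ x)) (trans (cong (splitAt w) eq) (splitAt-join w ℓ y))

    preimage : ∀ y → ∃[ x ] f x ≡ y
    preimage y with p , eq ← periodic y = iterate f p y , eq

    -- Iterates 1 to `duration` of the label `l` are vertices; the next one is the label `arrival`,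
    -- possibly `l` again.
    record FirstReturn (l : Fin ℓ) : Set where
      field
        duration : ℕ
        arrival  : Fin ℓ
        arrives  : iterate f (suc duration) (inj₂ l) ≡ inj₂ arrival
        before   : ∀ {i} → i < duration → ∃[ v ] iterate f (suc i) (inj₂ l) ≡ inj₁ v

    abstract
      firstReturn : ∀ l → FirstReturn l
      firstReturn l with p , eq ← periodic (inj₂ l) = search 0 p refl λ ()
        where
        search : ∀ k fuel → k + fuel ≡ p → (∀ {i} → i < k → ∃[ v ] iterate f (suc i) (inj₂ l) ≡ inj₁ v) → FirstReturn l
        search k fuel sum before with iterate f (suc k) (inj₂ l) in eq′
        ... | inj₂ m = record { duration = k ; arrival = m ; arrives = eq′ ; before = before }
        -- Iterate p + 1 is the label `l` itself, so the search cannot find a vertex there.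
        search k zero sum before | inj₁ v with refl ← trans (sym sum) (ℕ.+-identityʳ k) = ⊥-elim (inj₁≢inj₂ eq′ eq)
        search k (suc fuel) sum before | inj₁ v = search (suc k) fuel (trans (sym (ℕ.+-suc k fuel)) sum) before′
          where
          before′ : ∀ {i} → i < suc k → ∃[ v ] iterate f (suc i) (inj₂ l) ≡ inj₁ v
          before′ (s≤s i≤k) with ℕ.m≤n⇒m<n∨m≡n i≤k
          ... | inj₁ i<k  = before i<k
          ... | inj₂ refl = v , eq′

    open FirstReturn

    private
      -- Cancelling common iterates shows that the label `l′` is iterate i - i′ of `l`. Before the
      -- first return only iterate 0 is a label.
      ordered : ∀ {l l′} (R : FirstReturn l) {i i′} → i′ ≤ i → i ≤ duration R →
                iterate f (suc i) (inj₂ l) ≡ iterate f (suc i′) (inj₂ l′) → l ≡ l′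
      ordered R {i′ = i′} i′≤i i≤ eq with ℕ.m≤n⇒∃[o]m+o≡n i′≤i
      ... | zero  , refl = inj₂-injective (sym (iterate-cancel f-inj (suc i′) zero (sym eq)))
      ... | suc d , refl = ⊥-elim (inj₁≢inj₂ (proj₂ (before R (ℕ.≤-trans (ℕ.m≤n+m (suc d) i′) i≤)))
              (sym (iterate-cancel f-inj (suc i′) (suc d) (sym eq))))

    orbits-disjoint : ∀ {l l′} (R : FirstReturn l) (R′ : FirstReturn l′) {i i′} → i ≤ duration R → i′ ≤ duration R′ →
                      iterate f (suc i) (inj₂ l) ≡ iterate f (suc i′) (inj₂ l′) → l ≡ l′
    orbits-disjoint R R′ {i} {i′} i≤ i′≤ eq with ℕ.≤-total i i′
    ... | inj₁ i≤i′ = sym (ordered R′ i≤i′ i′≤ (sym eq))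
    ... | inj₂ i′≤i = ordered R i′≤i i≤ eq

  -- Linkages as permutations of vertices and labels

  module _ {arc : Fin w → Fin w → Set} {T : Fin w → Set} where

    Linkage : (Fin ℓ → Fin w) → Set
    Linkage a = LinkedAt arc T a (λ _ → ⊤)

    Step : Fin w → Node → Set
    Step v (inj₁ u) = v ≡ u ⊎ arc v u
    Step v (inj₂ _) = T v

    -- A linkage of a, closed up: every path end is sent to the label of its path, every label to the start
    -- of its path, and unused vertices are fixed.
    record Closure (a : Fin ℓ → Fin w) (Φ : Node → Node) : Set where
      field
        injective : Injective _≡_ _≡_ Φ
        starts    : ∀ l → Φ (inj₂ l) ≡ inj₁ (a l)
        steps     : ∀ v → Step v (Φ (inj₁ v))

    Simple : ∀ {v} → Path arc T v → Set
    Simple (stop _)         = ⊤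
    Simple (step {v} _ p)   = ¬ (v on p) × Simple p

    on? : ∀ z {v} (p : Path arc T v) → Dec (z on p)
    on? z {v} p with z ≟ v
    on? z p          | yes refl = yes here
    on? z (stop _)   | no z≢v  = no λ { here → z≢v refl }
    on? z (step a p) | no z≢v  with on? z p
    ... | yes o = yes (there o)
    ... | no ¬o = no λ { here → z≢v refl ; (there o) → ¬o o }

    suffix : ∀ {z v} (p : Path arc T v) → Simple p → z on p →
             ∃[ p′ ] Simple {z} p′ × (∀ {x} → x on p′ → x on p)
    suffix p          s       here      = p , s , id
    suffix (step a p) (_ , s) (there o) with p′ , s′ , sub ← suffix p s o = p′ , s′ , there ∘ sub

    -- Sending each vertex to its successor requires a path without repetitions. Shortcuts only
    -- remove vertices, so disjointness of a linkage survives.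
    simplify : ∀ {v} (p : Path arc T v) → ∃[ p′ ] Simple {v} p′ × (∀ {x} → x on p′ → x on p)
    simplify (stop t) = stop t , tt , id
    simplify (step {v} a p) with p′ , s , sub ← simplify p with on? v p′
    ... | yes o with p″ , s′ , sub′ ← suffix p′ s o = p″ , s′ , there ∘ sub ∘ sub′
    ... | no ¬o = step a p′ , (¬o , s) , λ { here → here ; (there o) → there (sub o) }

    module _ (l : Fin ℓ) where

      -- The last vertex is sent to the label `l`. Vertices off the path get the same value as a
      -- default, which `close` never uses.
      successor : ∀ {v} → Path arc T v → Fin w → Node
      successor (stop _) u = inj₂ l
      successor (step {v} {x} _ p) u with u ≟ v
      ... | yes _ = inj₁ x
      ... | no _  = successor p u

      successor-step : ∀ {v} (p : Path arc T v) {u} → u on p → Step u (successor p u)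
      successor-step (stop t) here = t
      successor-step (step {v} a p) {u} o with u ≟ v | o
      ... | yes refl | _       = inj₂ a
      ... | no u≢v  | here    = contradiction refl u≢v
      ... | no u≢v  | there o′ = successor-step p o′

      successor-on : ∀ {v} (p : Path arc T v) → Simple p → ∀ {u x} → u on p → successor p u ≡ inj₁ x → x on p × x ≢ v
      successor-on (stop t) _ here ()
      successor-on (step {v} a p) (v∉p , s) {u} o eq with u ≟ v | o
      successor-on (step {v} a p) (v∉p , s) o refl | yes refl | _ = there here , λ { refl → v∉p here }
      ... | no u≢v  | here    = contradiction refl u≢v
      ... | no u≢v  | there o′ with x∈p , _ ← successor-on p s o′ eq = there x∈p , λ { refl → v∉p x∈p }

      successor-label : ∀ {v} (p : Path arc T v) {u m} → successor p u ≡ inj₂ m → l ≡ m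
      successor-label (stop t) refl = refl
      successor-label (step {v} a p) {u} eq with u ≟ v
      successor-label (step {v} a p) {u} () | yes _
      ... | no _ = successor-label p {u} eq

      successor-injective : ∀ {v} (p : Path arc T v) → Simple p → ∀ {u u′} → u on p → u′ on p →
                            successor p u ≡ successor p u′ → u ≡ u′
      successor-injective (stop t) _ here here _ = refl
      successor-injective (step {v} a p) (v∉p , s) {u} {u′} o o′ eq with u ≟ v | u′ ≟ v | o | o′
      ... | yes refl | yes refl | _        | _         = refl
      ... | no u≢v  | _        | here     | _         = contradiction refl u≢v
      ... | _        | no u′≢v | _        | here      = contradiction refl u′≢v
      ... | yes refl | no _     | _        | there o₂  = contradiction refl (proj₂ (successor-on p s o₂ (sym eq)))
      ... | no _     | yes refl | there o₁ | _         = contradiction refl (proj₂ (successor-on p s o₁ eq))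
      ... | no _     | no _     | there o₁ | there o₂  = successor-injective p s o₁ o₂ eq

    module _ {a : Fin ℓ → Fin w} (linkage : Linkage a) where
      private
        P : ∀ l → Path arc T (a l)
        P l = proj₁ (simplify (proj₁ linkage l tt))
        simple : ∀ l → Simple (P l)
        simple l = proj₁ (proj₂ (simplify (proj₁ linkage l tt)))
        unique : ∀ {l m z} → z on P l → z on P m → l ≡ m
        unique {l} {m} o o′ with l ≟ m
        ... | yes eq = eq
        ... | no l≢m = ⊥-elim (proj₂ linkage tt tt l≢m (proj₂ (proj₂ (simplify (proj₁ linkage l tt))) o)
                                                       (proj₂ (proj₂ (simplify (proj₁ linkage m tt))) o′))

      close : Node → Node
      close (inj₂ l) = inj₁ (a l)
      close (inj₁ v) with any? (λ l → on? v (P l))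
      ... | yes (l , _) = successor l (P l) v
      ... | no _        = inj₁ v

      private
        Moved Fixed : Fin w → Set
        Moved v = ∃[ l ] v on P l × close (inj₁ v) ≡ successor l (P l) v
        Fixed v = (∀ l → ¬ (v on P l)) × close (inj₁ v) ≡ inj₁ v

        cases : ∀ v → Moved v ⊎ Fixed v
        cases v with any? (λ l → on? v (P l))
        ... | yes (l , o) = inj₁ (l , o , refl)
        ... | no ¬o       = inj₂ ((λ l o → ¬o (l , o)) , refl)

        label≢vertex : ∀ l v → inj₁ (a l) ≢ close (inj₁ v)
        label≢vertex l v eq with cases v
        ... | inj₂ (off , fix) = off l (subst (_on P l) (inj₁-injective (trans eq fix)) here)
        ... | inj₁ (m , o , mv) with al∈ , al≢ ← successor-on m (P m) (simple m) o (sym (trans eq mv))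
          with refl ← unique {l} {m} here al∈ = al≢ refl

        vertex-injective : ∀ v v′ → close (inj₁ v) ≡ close (inj₁ v′) → v ≡ v′
        vertex-injective v v′ eq with cases v | cases v′
        ... | inj₂ (_ , fix)    | inj₂ (_ , fix′)   = inj₁-injective (trans (sym fix) (trans eq fix′))
        ... | inj₂ (off , fix)  | inj₁ (m , o , mv) =
              contradiction (proj₁ (successor-on m (P m) (simple m) o (trans (sym mv) (trans (sym eq) fix)))) (off m)
        ... | inj₁ (m , o , mv) | inj₂ (off , fix)  =
              contradiction (proj₁ (successor-on m (P m) (simple m) o (trans (sym mv) (trans eq fix)))) (off m)
        ... | inj₁ (m , o , mv) | inj₁ (m′ , o′ , mv′) with successor m (P m) v in s
        ...   | inj₁ x with refl ← unique {m} {m′} (proj₁ (successor-on m (P m) (simple m) o s))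
                          (proj₁ (successor-on m′ (P m′) (simple m′) o′ (trans (sym mv′) (trans (sym eq) mv))))
                = successor-injective m (P m) (simple m) o o′ (trans s (trans (sym mv) (trans eq mv′)))
        ...   | inj₂ x with refl ← successor-label m (P m) {v} s
                       with refl ← successor-label m′ (P m′) {v′} (trans (sym mv′) (trans (sym eq) mv))
                = successor-injective m (P m) (simple m) o o′ (trans s (trans (sym mv) (trans eq mv′)))

      close-closure : Closure a close
      close-closure = record { injective = λ {x} {y} → inj x y ; starts = λ _ → refl ; steps = steps }
        where
        inj : ∀ x y → close x ≡ close y → x ≡ y
        inj (inj₂ l) (inj₂ m) eq = cong inj₂ (unique {l} {m} here (subst (_on P m) (sym (inj₁-injective eq)) here))
        inj (inj₂ l) (inj₁ v) eq = contradiction eq (label≢vertex l v)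
        inj (inj₁ v) (inj₂ l) eq = contradiction (sym eq) (label≢vertex l v)
        inj (inj₁ v) (inj₁ v′) eq = cong inj₁ (vertex-injective v v′ eq)
        steps : ∀ v → Step v (close (inj₁ v))
        steps v with cases v
        ... | inj₁ (l , o , mv) = subst (Step v) (sym mv) (successor-step l (P l) o)
        ... | inj₂ (_ , fix)    = subst (Step v) (sym fix) (inj₁ refl)

    module _ {a : Fin ℓ → Fin w} {Φ : Node → Node} (cl : Closure a Φ) where
      open Closure cl
      open Orbits injective
      open FirstReturn

      private
        Visited : ∀ {l} → FirstReturn l → Fin w → Set
        Visited {l} R z = ∃[ i ] i ≤ duration R × iterate Φ (suc i) (inj₂ l) ≡ inj₁ z

        follow : ∀ {l} (R : FirstReturn l) fuel i {v} → i + fuel ≡ duration R → iterate Φ (suc i) (inj₂ l) ≡ inj₁ v →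
                 Σ (Path arc T v) λ p → ∀ {z} → z on p → Visited R z
        follow R zero i sum eq with refl ← trans (sym (ℕ.+-identityʳ i)) sum = ⊥-elim (inj₁≢inj₂ eq (arrives R))
        follow {l} R (suc fuel) i {v} sum eq with Φ (inj₁ v) in eq′ | steps v
        ... | inj₂ _ | t = stop t , λ { here → i , subst (i ≤_) sum (ℕ.m≤m+n i (suc fuel)) , eq }
        ... | inj₁ u | st with p , visited ← follow R fuel (suc i) {u} (trans (sym (ℕ.+-suc i fuel)) sum)
                                               (trans (cong Φ eq) eq′)
              with st
        ...   | inj₁ refl = p , visited
        ...   | inj₂ arrow = step arrow p , λ { here → i , subst (i ≤_) sum (ℕ.m≤m+n i (suc fuel)) , eq ; (there o) → visited o }

        path : ∀ l → Σ (Path arc T (a l)) λ p → ∀ {z} → z on p → Visited (firstReturn l) z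
        path l = follow (firstReturn l) (duration (firstReturn l)) 0 refl (starts l)

      -- The orbit of a label up to the next label is a path to a sink, and such stretches are
      -- disjoint for different labels. The label reached may differ from the one at the start; the
      -- linkage records only that the last vertex is a sink.
      open-closure : Linkage a
      open-closure = (λ l _ → proj₁ (path l)) , λ {l} {m} _ _ l≢m o o′ →
        let i , i≤ , eq = proj₂ (path l) o ; j , j≤ , eq′ = proj₂ (path m) o′ in
        l≢m (orbits-disjoint (firstReturn l) (firstReturn m) i≤ j≤ (trans eq (sym eq′)))

    Marked : (Fin w → Set) → Fin ℓ → Node → Set
    Marked V l x = x ≡ inj₂ l ⊎ (∃[ v ] x ≡ inj₁ v × V v)

    module _ {a b : Fin ℓ → Fin w} {Φ Ψ : Node → Node} (clΦ : Closure a Φ) (clΨ : Closure b Ψ)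
             (V : Fin w → Set) (V? : ∀ v → Dec (V v)) (l m : Fin ℓ) where
      private
        module Φ = Closure clΦ
        module Ψ = Closure clΨ

      -- Φ is replaced by Ψ on V, and l takes over the start of m.
      switch : (∃[ y ] Marked V l y × Ψ (inj₂ m) ≡ Φ y) → (∀ v → V v → ∃[ y ] Marked V l y × Ψ (inj₁ v) ≡ Φ y) →
               ∃ (Closure (a [ l ≔ b m ]))
      switch at-m at-V = Φ′ , record { injective = λ {x} {y} → inj x y ; starts = λ _ → refl ; steps = steps }
        where
        Φ′ : Node → Node
        Φ′ (inj₂ l′) = inj₁ ((a [ l ≔ b m ]) l′)
        Φ′ (inj₁ v) with V? v
        ... | yes _ = Ψ (inj₁ v)
        ... | no _  = Φ (inj₁ v)
        Switched Kept : Node → Set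
        Switched x = (x ≡ inj₂ l × Φ′ x ≡ Ψ (inj₂ m)) ⊎ (∃[ v ] x ≡ inj₁ v × V v × Φ′ x ≡ Ψ (inj₁ v))
        Kept x = ¬ Marked V l x × Φ′ x ≡ Φ x
        cases : ∀ x → Switched x ⊎ Kept x
        cases (inj₂ l′) with l′ ≟ l
        ... | yes refl = inj₁ (inj₁ (refl , sym (Ψ.starts m)))
        ... | no l′≢l = inj₂ ((λ { (inj₁ refl) → l′≢l refl ; (inj₂ (_ , () , _)) }) , sym (Φ.starts l′))
        cases (inj₁ v) with V? v
        ... | yes Vv = inj₁ (inj₂ (v , refl , Vv , refl))
        ... | no ¬Vv = inj₂ ((λ { (inj₁ ()) ; (inj₂ (_ , refl , Vv)) → ¬Vv Vv }) , refl)
        -- The new values on the switched part are old values of `Φ` on the marked part, so they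
        -- cannot collide with those of `Φ` on the kept part.
        source : ∀ {x} → Switched x → ∃[ y ] Marked V l y × Φ′ x ≡ Φ y
        source (inj₁ (_ , eq)) = let y , my , eq′ = at-m in y , my , trans eq eq′
        source (inj₂ (v , _ , Vv , eq)) = let y , my , eq′ = at-V v Vv in y , my , trans eq eq′
        clash : ∀ {x y} → Switched x → Kept y → Φ′ x ≢ Φ′ y
        clash s (¬my , eq) eq″ with y′ , my′ , eq′ ← source s
          with refl ← Φ.injective (trans (sym eq′) (trans eq″ eq)) = ¬my my′
        both : ∀ {x y} → Switched x → Switched y → Φ′ x ≡ Φ′ y → x ≡ y
        both (inj₁ (refl , _)) (inj₁ (refl , _)) _ = refl
        both (inj₁ (refl , p)) (inj₂ (v , refl , _ , p′)) eq with () ← Ψ.injective (trans (sym p) (trans eq p′))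
        both (inj₂ (v , refl , _ , p)) (inj₁ (refl , p′)) eq with () ← Ψ.injective (trans (sym p) (trans eq p′))
        both (inj₂ (v , refl , _ , p)) (inj₂ (v′ , refl , _ , p′)) eq = Ψ.injective (trans (sym p) (trans eq p′))
        inj : ∀ x y → Φ′ x ≡ Φ′ y → x ≡ y
        inj x y eq with cases x | cases y
        ... | inj₁ s        | inj₁ s′        = both s s′ eq
        ... | inj₁ s        | inj₂ k         = contradiction eq (clash s k)
        ... | inj₂ k        | inj₁ s         = contradiction (sym eq) (clash s k)
        ... | inj₂ (_ , p)  | inj₂ (_ , p′)  = Φ.injective (trans (sym p) (trans eq p′))
        steps : ∀ v → Step v (Φ′ (inj₁ v))
        steps v with V? v
        ... | yes _ = Ψ.steps v
        ... | no _  = Φ.steps v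

    -- The exchange bijection sends a label to the first label on its orbit under Ψ⁻¹ ∘ Φ.
    closures-exchange : ∀ {a b Φ Ψ} → Closure a Φ → Closure b Ψ → ∃[ σ ] Injective _≡_ _≡_ σ × (∀ l →
      Linkage (a [ l ≔ b (σ l) ]) × Linkage (b [ σ l ≔ a l ]) × (∀ l′ → b (σ l) ≡ a l′ → l′ ≡ l))
    closures-exchange {a} {b} {Φ} {Ψ} clΦ clΨ = arrival ∘ firstReturn ,
      (λ {l} {l′} eq → orbits-disjoint (firstReturn l) (firstReturn l′) ℕ.≤-refl ℕ.≤-refl
        (trans (arrives (firstReturn l)) (trans (cong inj₂ eq) (sym (arrives (firstReturn l′)))))) ,
      exchange
      where
      open Orbits (Closure.injective clΨ) using (preimage)
      τ : Node → Node
      τ x = proj₁ (preimage (Φ x))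
      Ψτ : ∀ x → Ψ (τ x) ≡ Φ x
      Ψτ x = proj₂ (preimage (Φ x))
      τ-inj : Injective _≡_ _≡_ τ
      τ-inj {x} {y} eq = Closure.injective clΦ (trans (sym (Ψτ x)) (trans (cong Ψ eq) (Ψτ y)))
      open Orbits τ-inj using (firstReturn; orbits-disjoint; module FirstReturn)
      open FirstReturn
      exchange : ∀ l → let σl = arrival (firstReturn l) in
        Linkage (a [ l ≔ b σl ]) × Linkage (b [ σl ≔ a l ]) × (∀ l′ → b σl ≡ a l′ → l′ ≡ l)
      -- `V` is the set of vertices strictly between the labels `l` and `m` on the orbit. From Ψ ∘ τ
      -- = Φ, the values of `Ψ` on O 1, ..., O (K + 1) are those of `Φ` on O 0, ..., O K. Hence
      -- switching on `V` is legitimate in both directions.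
      exchange l = open-closure (proj₂ (switch clΦ clΨ V V? l m
            (O K , marked ℕ.≤-refl , trans (cong Ψ (sym (arrives R))) (Ψτ (O K)))
            λ v (i , i<K , eq) → O i , marked (ℕ.<⇒≤ i<K) , trans (cong Ψ (sym eq)) (Ψτ (O i)))) ,
          open-closure (proj₂ (switch clΨ clΦ V V? m l
            (O 1 , marked′ z≤n , sym (Ψτ (O 0)))
            λ v (i , i<K , eq) → O (suc (suc i)) , marked′ i<K , trans (cong Φ (sym eq)) (sym (Ψτ (O (suc i)))))) ,
          fresh
        where
        R = firstReturn l
        K = duration R
        m = arrival R
        O : ℕ → Node
        O i = iterate τ i (inj₂ l)
        V : Fin w → Set
        V v = ∃[ i ] i < K × O (suc i) ≡ inj₁ v
        V? : ∀ v → Dec (V v)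
        V? v = map′ (λ (i , eq) → toℕ i , toℕ<n i , eq)
          (λ (i , i<K , eq) → fromℕ< i<K , trans (cong (O ∘ suc) (toℕ-fromℕ< i<K)) eq)
          (any? λ (i : Fin K) → ≡-dec _≟_ _≟_ (O (suc (toℕ i))) (inj₁ v))
        marked : ∀ {i} → i ≤ K → Marked V l (O i)
        marked {zero}  _   = inj₁ refl
        marked {suc i} i<K with v , eq ← before R i<K = inj₂ (v , eq , i , i<K , eq)
        marked′ : ∀ {i} → i ≤ K → Marked V m (O (suc i))
        marked′ i≤K with ℕ.m≤n⇒m<n∨m≡n i≤K
        ... | inj₂ refl = inj₁ (arrives R)
        ... | inj₁ i<K with v , eq ← before R i<K = inj₂ (v , eq , _ , i<K , eq)
        -- An element of both bases can be matched only with itself: the equality makes the label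
        -- `l′` equal to O K, which is a vertex unless K = 0.
        fresh : ∀ l′ → b m ≡ a l′ → l′ ≡ l
        fresh l′ eq = at K ℕ.≤-refl (Closure.injective clΦ (begin
          Φ (inj₂ l′)      ≡⟨ Closure.starts clΦ l′ ⟩
          inj₁ (a l′)      ≡⟨ cong inj₁ eq ⟨
          inj₁ (b m)       ≡⟨ Closure.starts clΨ m ⟨
          Ψ (inj₂ m)       ≡⟨ cong Ψ (arrives R) ⟨
          Ψ (O (suc K))    ≡⟨ Ψτ (O K) ⟩
          Φ (O K)          ∎))
          where
          open ≡-Reasoning
          at : ∀ i → i ≤ K → inj₂ l′ ≡ O i → l′ ≡ l
          at zero    _   eq′ = inj₂-injective eq′
          at (suc i) i<K eq′ = ⊥-elim (inj₁≢inj₂ (proj₂ (before R i<K)) (sym eq′))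

    abstract
      base-orderable : ∀ {a b} → Linkage a → Linkage b → ∃[ σ ] Injective _≡_ _≡_ σ × (∀ l →
        Linkage (a [ l ≔ b (σ l) ]) × Linkage (b [ σ l ≔ a l ]) × (∀ l′ → b (σ l) ≡ a l′ → l′ ≡ l))
      base-orderable La Lb = closures-exchange (close-closure La) (close-closure Lb)

-- The es-splitting of a matroid with a G₈ minor

enumerate : ∀ {n} (S : Subset n) → ∃[ b ] Σ (Fin b → Fin n) λ c →
            Injective _≡_ _≡_ c × (∀ i → c i ∈ S) × (∀ {j} → j ∈ S → ∃[ i ] c i ≡ j)
enumerate [] = 0 , (λ ()) , (λ { {()} }) , (λ ()) , λ ()
enumerate (false ∷ S) with b , c , inj , sound , complete ← enumerate S =
  b , suc ∘ c , inj ∘ suc-injective , there ∘ sound , λ { (there p) → let i , eq = complete p in i , cong suc eq }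
enumerate (true ∷ S) with b , c , inj , sound , complete ← enumerate S =
  suc b , c′ , (λ {i} {j} → inj′ i j) , (λ { zero → here ; (suc i) → there (sound i) }) ,
  λ { here → zero , refl ; (there p) → let i , eq = complete p in suc i , cong suc eq }
  where
  c′ : Fin (suc b) → Fin _
  c′ zero    = zero
  c′ (suc i) = suc (c i)
  inj′ : ∀ i j → c′ i ≡ c′ j → i ≡ j
  inj′ zero    zero    _  = refl
  inj′ (suc i) (suc j) eq = cong suc (inj (suc-injective eq))

∷-injective : ∀ {m} {E : Set} {v : E} {g : Fin m → E} → Injective _≡_ _≡_ g → (∀ i → g i ≢ v) →
              Injective _≡_ _≡_ (v F.∷ g)
∷-injective inj new {zero}  {zero}  _  = refl
∷-injective inj new {zero}  {suc j} eq = contradiction (sym eq) (new j)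
∷-injective inj new {suc i} {zero}  eq = contradiction eq (new i)
∷-injective inj new {suc i} {suc j} eq = cong suc (inj eq)

Range : ∀ {m} {E : Set} → (Fin m → E) → E → Set
Range x z = ∃[ l ] x l ≡ z

on-subst : ∀ {W : Set} {arc : W → W → Set} {T : W → Set} {u v z : W} (eq : u ≡ v) {p : Path arc T u} →
           z on subst (Path arc T) eq p → z on p
on-subst refl o = o

module _ {r N} (M : Matrix r N) {Γ emb T} (lk : ∀ I → VecMatroid M I ⇔ Linked Γ emb T I) where

  Arc : Fin (nW Γ) → Fin (nW Γ) → Set
  Arc u v = arc Γ u v ≡ true

  -- After an exchange `x` is not known to be injective, so each element of the range takes the path
  -- of one of its labels.
  linkage⇒free : ∀ {ℓ} {a : Fin ℓ → Fin (nW Γ)} (x : Fin ℓ → Fin N) → (∀ l → a l ≡ emb (x l)) →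
                 Linkage {arc = Arc} {T = _∈ T} a → Free M (Range x)
  linkage⇒free {ℓ} {a} x a≡ (P , disj) = Free-mono M (λ _ → ∈-subsetOf⁺ range?)
    (LinIndep⇒Free M (Equivalence.from (lk I) (LinkedAt⇒Linked (Q , disj′))))
    where
    range? : ∀ z → Dec (Range x z)
    range? z = any? λ l → x l ≟ z
    I = subsetOf range?
    start≡ : ∀ {z} ((l , _) : Range x z) → a l ≡ emb z
    start≡ (l , refl) = a≡ l
    Q : ∀ z → z ∈ I → Path Arc (_∈ T) (emb z)
    Q z z∈ = subst (Path Arc (_∈ T)) (start≡ (∈-subsetOf⁻ range? z∈)) (P (proj₁ (∈-subsetOf⁻ range? z∈)) tt)
    disj′ : ∀ {z z′} i i′ → z ≢ z′ → ∀ {v} → v on Q z i → v on Q z′ i′ → ⊥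
    disj′ i i′ z≢z′ o o′ = disj tt tt
      (λ eq → z≢z′ (trans (sym (proj₂ (∈-subsetOf⁻ range? i))) (trans (cong x eq) (proj₂ (∈-subsetOf⁻ range? i′)))))
      (on-subst (start≡ (∈-subsetOf⁻ range? i)) o) (on-subst (start≡ (∈-subsetOf⁻ range? i′)) o′)

  free⇒linkage : ∀ {ℓ} (x : Fin ℓ → Fin N) → Injective _≡_ _≡_ x → Free M (Range x) →
                 Linkage {arc = Arc} {T = _∈ T} (emb ∘ x)
  free⇒linkage x inj free = (λ l _ → proj₁ linked (x l) (mem l)) , λ _ _ l≢m → proj₂ linked _ _ (l≢m ∘ inj)
    where
    range? : ∀ z → Dec (Range x z)
    range? z = any? λ l → x l ≟ z
    mem : ∀ l → x l ∈ subsetOf range?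
    mem l = ∈-subsetOf⁺ range? (l , refl)
    linked = Linked⇒LinkedAt (Equivalence.to (lk (subsetOf range?))
      (Free⇒LinIndep M (Free-mono M (λ _ → ∈-subsetOf⁻ range?) free)))

≔-∘ : ∀ {ℓ} {E W : Set} (emb : E → W) (x : Fin ℓ → E) l z l′ → ((emb ∘ x) [ l ≔ emb z ]) l′ ≡ emb ((x [ l ≔ z ]) l′)
≔-∘ emb x l z l′ with l′ ≟ l
... | yes _ = refl
... | no _  = refl

-- The circuits of G₈ and their preimages in B

pattern ta = zero
pattern tb = suc zero
pattern ab₁ = suc (suc zero)
pattern ab₂ = suc (suc (suc zero))

G₈-free-tb-ab₁ : ∀ p → p tb ≡ false → p ab₁ ≡ false → Free (incidence G₈) (p ∋_)
G₈-free-tb-ab₁ p pb p1 k ck k⊑ = zero′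
  where
  a≡b = proj₁ (G₈-cycles k ck)
  a≡ = proj₂ (G₈-cycles k ck)
  kb : k tb ≡ false
  kb = ¬-not λ s → true≢false (k⊑ tb s) pb
  k1 : k ab₁ ≡ false
  k1 = ¬-not λ s → true≢false (k⊑ ab₁ s) p1
  zero′ : Zero k
  zero′ ta  = trans a≡b kb
  zero′ tb  = kb
  zero′ ab₁ = k1
  zero′ ab₂ = trans (cong (_xor k ab₂) (sym k1)) (trans (sym a≡) (trans a≡b kb))

G₈-free-ab₁-ab₂ : ∀ p → p ab₁ ≡ false → p ab₂ ≡ false → Free (incidence G₈) (p ∋_)
G₈-free-ab₁-ab₂ p p1 p2 k ck k⊑ = zero′
  where
  k1 : k ab₁ ≡ false
  k1 = ¬-not λ s → true≢false (k⊑ ab₁ s) p1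
  k2 : k ab₂ ≡ false
  k2 = ¬-not λ s → true≢false (k⊑ ab₂ s) p2
  ka : k ta ≡ false
  ka = trans (proj₂ (G₈-cycles k ck)) (cong₂ _xor_ k1 k2)
  zero′ : Zero k
  zero′ ta  = ka
  zero′ tb  = trans (sym (proj₁ (G₈-cycles k ck))) ka
  zero′ ab₁ = k1
  zero′ ab₂ = k2

dot-comm : ∀ {n} (f g : Chain n) → dot f g ≡ dot g f
dot-comm f g = xorFin-cong λ j → ∧-comm (f j) (g j)

IsG₈Circuit : Chain 4 → Set
IsG₈Circuit = IsCircuit (incidence G₈)

quad-false : ∀ y → quad false false false false y ≡ false
quad-false ta  = refl
quad-false tb  = refl
quad-false ab₁ = refl
quad-false ab₂ = refl

G₈-cycle-form : ∀ h → Cyc (incidence G₈) h → ∀ {c d} → h ab₁ ≡ c → h ab₂ ≡ d → h ≗ quad (c xor d) (c xor d) c d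
G₈-cycle-form h ch refl refl with p , p′ ← G₈-cycles h ch = quad-≗ h p′ (trans (sym p) p′) refl refl

circuit-ta-tb-ab₁ : IsG₈Circuit (quad true true true false)
circuit-ta-tb-ab₁ = three refl refl refl , λ h ch h⊑ → let d = ¬-not λ s → true≢false (h⊑ ab₂ s) refl in
  [ (λ c → inj₂ (G₈-cycle-form h ch c d)) , (λ c → inj₁ λ y → trans (G₈-cycle-form h ch c d y) (quad-false y)) ]′
    (true⊎false (h ab₁))

circuit-ta-tb-ab₂ : IsG₈Circuit (quad true true false true)
circuit-ta-tb-ab₂ = three refl refl refl , λ h ch h⊑ → let c = ¬-not λ s → true≢false (h⊑ ab₁ s) refl in
  [ (λ d → inj₂ (G₈-cycle-form h ch c d)) , (λ d → inj₁ λ y → trans (G₈-cycle-form h ch c d y) (quad-false y)) ]′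
    (true⊎false (h ab₂))

circuit-ab₁-ab₂ : IsG₈Circuit (quad false false true true)
circuit-ab₁-ab₂ = three refl refl refl , λ h ch h⊑ →
  let c≡d = xor≡false⇒≡ (trans (sym (proj₂ (G₈-cycles h ch))) (¬-not λ s → true≢false (h⊑ ta s) refl)) in
  [ (λ c → inj₂ (G₈-cycle-form h ch c (trans (sym c≡d) c)))
  , (λ c → inj₁ λ y → trans (G₈-cycle-form h ch c (trans (sym c≡d) c) y) (quad-false y)) ]′ (true⊎false (h ab₁))

module _ {r n} {A : Matrix r n} {B : Matroid n} (rep : Represents A B)
         {BC : Subset n} {f : Fin 4 → Fin n} (f-inj : Injective _≡_ _≡_ f) (f∉BC : ∀ y → f y ∉ BC)
         (minor : ∀ I → CycleMatroid G₈ I ⇔ B (image f I ∪ BC)) where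

  Support : Fin n → Set
  Support j = Range f j ⊎ j ∈ BC

  support⇒∈ : ∀ {h : Chain n} {I} → h ⊑ Support → (∀ y → h ∋ f y → y ∈ I) → h ⊑ (_∈ image f I ∪ BC)
  support⇒∈ h⊑ tr j hj with h⊑ j hj
  ... | inj₁ (y , refl) = x∈p∪q⁺ (inj₁ (∈-image⁺ f (tr y hj)))
  ... | inj₂ j∈         = x∈p∪q⁺ (inj₂ j∈)

  -- The trace of `h` is independent in the minor, so together with `BC` it is independent in `B`,
  -- and it contains all of `h`. Applied to sums, this shows that a cycle in the support is
  -- determined by its trace.
  trace-free : ∀ h → Cyc A h → h ⊑ Support → Free (incidence G₈) ((h ∘ f) ∋_) → Zero h
  trace-free h ch h⊑ free = LinIndep⇒Free A (Equivalence.to (rep _) (Equivalence.to (minor I)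
      (Free⇒acyclic G₈ (Free-mono (incidence G₈) (λ _ → ∈-tabulate⁻ {f = h ∘ f}) free)))) h ch
      (support⇒∈ {h} {I} h⊑ λ y → ∈-tabulate⁺ {f = h ∘ f})
    where
    I : Subset 4
    I = tabulate (h ∘ f)

  abstract
    -- As `g` is dependent in the minor, its image together with `BC` contains a nonzero cycle. The
    -- trace of that cycle is inside `g`; were it a proper part of the circuit, it would be
    -- independent, against `trace-free`.
    trace-circuit : ∀ {g} → IsG₈Circuit g → ∃ (g ∋_) → ∃[ Z ] Cyc A Z × Z ⊑ Support × Z ∘ f ≗ g
    trace-circuit {g} (cg , circ) (y₀ , gy₀)
      with anyChain? {P = λ Z → Cyc A Z × Z ⊑ (_∈ image f (tabulate g) ∪ BC) × ∃ (Z ∋_)}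
        (λ f≗g (c , f⊑ , j , fj) → Cyc-cong A f≗g c , (λ i gi → f⊑ i (trans (f≗g i) gi)) , j , trans (sym (f≗g j)) fj)
        (λ Z → Cyc? A Z ×-dec all? (λ j → (Z j Bool.≟ true) →-dec (j ∈? image f (tabulate g) ∪ BC)) ×-dec any? (λ j → Z j Bool.≟ true))
    ... | no none = ⊥-elim (true≢false gy₀ (acyclic⇒Free G₈ (Equivalence.from (minor (tabulate g))
            (Equivalence.from (rep _) (Free⇒LinIndep A λ Z cZ Z⊑ j → ¬-not λ Zj → none (Z , cZ , Z⊑ , j , Zj))))
            g cg (λ _ → ∈-tabulate⁺ {f = g}) y₀))
    ... | yes (Z , cZ , Z⊑ , j₀ , Zj₀) = Z , cZ , Z⊑′ , λ y → agree y (true⊎false (g y))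
      where
      Z⊑′ : Z ⊑ Support
      Z⊑′ j Zj with x∈p∪q⁻ (image f (tabulate g)) BC (Z⊑ j Zj)
      ... | inj₂ j∈ = inj₂ j∈
      ... | inj₁ j∈ with y , _ , eq ← ∈-image⁻ f {tabulate g} j∈ = inj₁ (y , eq)
      Z∘f⊑ : ∀ y → Z ∋ f y → g ∋ y
      Z∘f⊑ y Zy with x∈p∪q⁻ (image f (tabulate g)) BC (Z⊑ (f y) Zy)
      ... | inj₂ y∈ = contradiction y∈ (f∉BC y)
      ... | inj₁ y∈ with y′ , y′∈ , eq ← ∈-image⁻ f {tabulate g} y∈ = subst (g ∋_) (f-inj eq) (∈-tabulate⁻ {f = g} y′∈)
      agree : ∀ y → g ∋ y ⊎ g y ≡ false → Z (f y) ≡ g y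
      agree y (inj₂ gy) = trans (¬-not λ Zy → true≢false (Z∘f⊑ y Zy) gy) (sym gy)
      agree y (inj₁ gy) = trans (¬-not λ Zy → true≢false Zj₀ (trace-free Z cZ Z⊑′ (λ k ck k⊑ →
        [ id , (λ k≗g → ⊥-elim (true≢false (k⊑ y (trans (k≗g y) gy)) Zy)) ]′ (circ k ck λ x kx → Z∘f⊑ x (k⊑ x kx))) j₀)) (sym gy)

  X : Subset n
  X = tabulate (δ (f ta) ⊕ δ (f ab₁))

  e : Fin n
  e = f ta

  f-≢ : ∀ {y y′} → y ≢ y′ → f y ≢ f y′
  f-≢ y≢y′ = y≢y′ ∘ f-inj

  e∈X : e ∈ X
  e∈X = ∈-tabulate⁺ (cong₂ _xor_ (δ-refl (f ta)) (δ-≢ (f-≢ {ab₁} {ta} λ ())))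

  2≤∣X∣ : 2 ≤ ∣ X ∣
  2≤∣X∣ = subst (_< ∣ X ∣) (∣⁅x⁆∣≡1 e) (p⊂q⇒∣p∣<∣q∣
    ((λ x∈ → subst (_∈ X) (sym (x∈⁅y⁆⇒x≡y e x∈)) e∈X) , f ab₁ ,
      ∈-tabulate⁺ (cong₂ _xor_ (δ-≢ (f-≢ {ta} {ab₁} λ ())) (δ-refl (f ab₁))) ,
      λ x∈ → f-≢ {ab₁} {ta} (λ ()) (x∈⁅y⁆⇒x≡y e x∈)))

  dot-X : ∀ h → dot h (lookup X) ≡ h (f ta) xor h (f ab₁)
  dot-X h = begin
    dot h (lookup X)                            ≡⟨ dot-comm h (lookup X) ⟩
    dot (lookup X) h                            ≡⟨ dot-cong h (lookup∘tabulate (δ (f ta) ⊕ δ (f ab₁))) ⟩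
    dot (δ (f ta) ⊕ δ (f ab₁)) h                ≡⟨ dot-⊕ (δ (f ta)) (δ (f ab₁)) h ⟩
    dot (δ (f ta)) h xor dot (δ (f ab₁)) h      ≡⟨ cong₂ _xor_ (dot-δ (f ta) h) (dot-δ (f ab₁) h) ⟩
    h (f ta) xor h (f ab₁)                      ∎
    where open ≡-Reasoning

  module K₄ {b} {c : Fin b → Fin n} (c-inj : Injective _≡_ _≡_ c) (c∈ : ∀ i → c i ∈ BC)
            (c-onto : ∀ {j} → j ∈ BC → Range c j) where

    N : Matrix (suc r) (suc (suc n))
    N = esSplit A X e

    el-injective : ∀ {i j : Fin n} → _≡_ {A = Fin (suc (suc n))} (el i) (el j) → i ≡ j
    el-injective refl = refl

    f≢c : ∀ y i → c i ≢ f y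
    f≢c y i eq = f∉BC y (subst (_∈ BC) eq (c∈ i))

    rest : Fin b → Fin (suc (suc n))
    rest i = el (c i)

    -- Under the identification of the es-splitting of G₈ with M(K₄), two complementary Hamiltonian paths.
    path₁ path₂ : Fin (suc (suc (suc b))) → Fin (suc (suc n))
    path₁ = q F.∷ γ F.∷ el (f tb) F.∷ rest
    path₂ = el (f ta) F.∷ el (f ab₂) F.∷ el (f ab₁) F.∷ rest

    rest-inj : Injective _≡_ _≡_ rest
    rest-inj eq = c-inj (el-injective eq)

    path₁-inj : Injective _≡_ _≡_ path₁
    path₁-inj = ∷-injective (∷-injective (∷-injective rest-inj (λ i eq → f≢c tb i (el-injective eq)))
      (λ { zero () ; (suc i) () })) (λ { zero () ; (suc zero) () ; (suc (suc i)) () })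

    path₂-inj : Injective _≡_ _≡_ path₂
    path₂-inj = ∷-injective (∷-injective (∷-injective rest-inj (λ i eq → f≢c ab₁ i (el-injective eq)))
      (λ { zero eq → f-≢ {ab₁} {ab₂} (λ ()) (el-injective eq) ; (suc i) eq → f≢c ab₂ i (el-injective eq) }))
      (λ { zero eq → f-≢ {ab₂} {ta} (λ ()) (el-injective eq) ; (suc zero) eq → f-≢ {ab₁} {ta} (λ ()) (el-injective eq)
         ; (suc (suc i)) eq → f≢c ta i (el-injective eq) })

    Z₁ = trace-circuit circuit-ta-tb-ab₁ (ta , refl)
    Z₂ = trace-circuit circuit-ta-tb-ab₂ (ta , refl)
    Z₃ = trace-circuit circuit-ab₁-ab₂ (ab₁ , refl)

    path₁-free : Free N (Range path₁)
    path₁-free Y cY Y⊑ = zeroY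
      where
      h = merge A X e Y
      only : ∀ {j} → Y ∋ el j → j ≡ f tb ⊎ Range c j
      only {j} Yj with Y⊑ (el j) Yj
      ... | suc (suc zero) , eq    = inj₁ (sym (el-injective eq))
      ... | suc (suc (suc i)) , eq = inj₂ (i , el-injective eq)
      off : ∀ y → y ≢ tb → Y (el (f y)) ≡ false
      off y y≢tb = ¬-not λ Yy → [ f-≢ y≢tb , (λ (i , eq) → f≢c y i eq) ]′ (only Yy)
      off′ : ∀ y → y ≢ tb → y ≢ ta → h (f y) ≡ false
      off′ y y≢tb y≢ta = trans (xor-∧δ-≢ A X e (Y (el (f y))) (Y γ) (f-≢ y≢ta)) (off y y≢tb)
      h⊑ : h ⊑ Support
      h⊑ j hj with xor-∧δ-true A X e (Y (el j)) (Y γ) hj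
      ... | inj₂ j≡e = inj₁ (ta , sym j≡e)
      ... | inj₁ Yj with only Yj
      ...   | inj₁ j≡ = inj₁ (tb , sym j≡)
      ...   | inj₂ (i , refl) = inj₂ (c∈ i)
      h≡0 : Zero h
      -- On G₈ the merge lives on {ta, tb}, a spanning tree.
      h≡0 = trace-free h (Cyc-merge A X e {Y} cY) h⊑
        (G₈-free-ab₁-ab₂ (h ∘ f) (off′ ab₁ (λ ()) (λ ())) (off′ ab₂ (λ ()) (λ ())))
      Yγ : Y γ ≡ false
      Yγ = trans (cong (_xor Y γ) (sym (off ta λ ()))) (trans (sym (xor-∧δ-e A X e (Y (el (f ta))) (Y γ))) (h≡0 (f ta)))
      Yel : ∀ j → Y (el j) ≡ false
      Yel j = trans (sym (xor-identityʳ (Y (el j)))) (trans (cong (λ z → Y (el j) xor (z ∧ δ e j)) (sym Yγ)) (h≡0 j))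
      zeroY : Zero Y
      zeroY q      = trans (Cyc-q A X e {Y} cY) (dot-zero (lookup X) Yel)
      zeroY γ      = Yγ
      zeroY (el j) = Yel j

    -- `Y` avoids `q` and `γ`, so it is a cycle of `A` meeting `X` evenly. If it contains `ab₁`, it
    -- is the cycle with trace {ab₁, ab₂}, which meets `X` in `ab₁` alone; otherwise its trace lies
    -- in the spanning tree {ta, ab₂}.
    path₂-free : Free N (Range path₂)
    path₂-free Y cY Y⊑ = [ (λ h2 → ⊥-elim (true≢false (Yq-odd h2) Yq)) , zeroY ]′ (true⊎false (h (f ab₁)))
      where
      h = merge A X e Y
      Yq : Y q ≡ false
      Yq = ¬-not λ s → out (Y⊑ q s)
        where
        out : ¬ Range path₂ q
        out (zero , ())
        out (suc zero , ())
        out (suc (suc zero) , ())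
        out (suc (suc (suc i)) , ())
      Yγ : Y γ ≡ false
      Yγ = ¬-not λ s → out (Y⊑ γ s)
        where
        out : ¬ Range path₂ γ
        out (zero , ())
        out (suc zero , ())
        out (suc (suc zero) , ())
        out (suc (suc (suc i)) , ())
      h≗ : ∀ j → h j ≡ Y (el j)
      h≗ j = trans (cong (λ z → Y (el j) xor (z ∧ δ e j)) Yγ) (xor-identityʳ (Y (el j)))
      h⊑ : h ⊑ (λ j → (∃[ y ] y ≢ tb × f y ≡ j) ⊎ j ∈ BC)
      h⊑ j hj with Y⊑ (el j) (trans (sym (h≗ j)) hj)
      ... | zero , eq              = inj₁ (ta , (λ ()) , el-injective eq)
      ... | suc zero , eq          = inj₁ (ab₂ , (λ ()) , el-injective eq)
      ... | suc (suc zero) , eq    = inj₁ (ab₁ , (λ ()) , el-injective eq)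
      ... | suc (suc (suc i)) , refl = inj₂ (c∈ i)
      h⊑′ : h ⊑ Support
      h⊑′ j hj = [ (λ (y , _ , eq) → inj₁ (y , eq)) , inj₂ ]′ (h⊑ j hj)
      h-tb : h (f tb) ≡ false
      h-tb = ¬-not λ s → [ (λ (y , y≢tb , eq) → y≢tb (f-inj eq)) , f∉BC tb ]′ (h⊑ (f tb) s)
      ch : Cyc A h
      ch = Cyc-merge A X e {Y} cY
      zeroY : h (f ab₁) ≡ false → Zero Y
      zeroY h1 q      = Yq
      zeroY h1 γ      = Yγ
      zeroY h1 (el j) = trans (sym (h≗ j)) (trace-free h ch h⊑′ (G₈-free-tb-ab₁ (h ∘ f) h-tb h1) j)
      Yq-odd : h ∋ f ab₁ → Y ∋ q
      Yq-odd h1 with Z , cZ , Z⊑ , Z∘f ← Z₃ = begin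
        Y q                                 ≡⟨ Cyc-q A X e {Y} cY ⟩
        dot (λ j → Y (el j)) (lookup X)     ≡⟨ dot-cong (lookup X) h≗ ⟨
        dot h (lookup X)                    ≡⟨ dot-X h ⟩
        h (f ta) xor h (f ab₁)              ≡⟨ cong₂ _xor_ (trans (h≗Z (f ta)) (Z∘f ta)) h1 ⟩
        true                                ∎
        where
        open ≡-Reasoning
        h≗Z : h ≗ Z
        h≗Z j = xor≡false⇒≡ (trace-free (h ⊕ Z) (Cyc-⊕ A ch cZ) (λ j s → [ h⊑′ j , Z⊑ j ]′ (xor-true {h j} s))
          (G₈-free-tb-ab₁ ((h ⊕ Z) ∘ f) (cong₂ _xor_ h-tb (Z∘f tb)) (cong₂ _xor_ h1 (Z∘f ab₁))) j)

    lift-dependent : ∀ {P : Fin (suc (suc n)) → Set} s {Z} → Cyc A Z → Z ⊑ Support → (∀ i → P (rest i)) →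
      (lift A X e s Z ∋ q → P q) → (s ≡ true → P γ) → (∀ y → lift A X e s Z ∋ el (f y) → P (el (f y))) →
      ∀ {x} → lift A X e s Z ∋ x → ¬ Free N P
    lift-dependent {P} s {Z} cZ Z⊑ onBC onq onγ onf {x} D∋x free =
      true≢false D∋x (free (lift A X e s Z) (Cyc-lift A X e s cZ) within x)
      where
      within : lift A X e s Z ⊑ P
      within q      p = onq p
      within γ      p = onγ p
      within (el j) p with xor-∧δ-true A X e (Z j) s p
      ... | inj₂ refl = onf ta p
      ... | inj₁ Zj with Z⊑ j Zj
      ...   | inj₁ (y , refl) = onf y p
      ...   | inj₂ j∈ with i , refl ← c-onto j∈ = onBC i

    lift-f : ∀ s {Z g} → Z ∘ f ≗ g → ∀ y → y ≢ ta → lift A X e s Z (el (f y)) ≡ g y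
    lift-f s {Z} Z∘f y y≢ta = trans (xor-∧δ-≢ A X e (Z (f y)) s (f-≢ y≢ta)) (Z∘f y)

    lift-e : ∀ s {Z g} → Z ∘ f ≗ g → lift A X e s Z (el (f ta)) ≡ g ta xor s
    lift-e s {Z} Z∘f = trans (xor-∧δ-e A X e (Z (f ta)) s) (cong (_xor s) (Z∘f ta))

    lift-q : ∀ s {Z g} → Z ∘ f ≗ g → lift A X e s Z q ≡ (g ta xor s) xor g ab₁
    lift-q s {Z} Z∘f = trans (dot-X (λ j → lift A X e s Z (el j))) (cong₂ _xor_ (lift-e s {Z} Z∘f) (lift-f s {Z} Z∘f ab₁ λ ()))

    -- This and the next three are the triangles of K₄ modulo `BC`. The coefficient at `γ` is chosen
    -- by hand, and `lift-q` then decides whether `q` belongs to the cycle.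
    dependent-q-γ-ta : ∀ {P} → (∀ i → P (rest i)) → P q → P γ → P (el (f ta)) → ¬ Free N P
    dependent-q-γ-ta {P} onBC pq pγ pa = lift-dependent {P} true {λ _ → false} (λ i → dot-zero (A i) λ _ → refl) (λ _ ()) onBC
      (λ _ → pq) (λ _ → pγ) onf {γ} refl
      where
      onf : ∀ y → lift A X e true (λ _ → false) ∋ el (f y) → P (el (f y))
      onf y p with refl ← f-inj {ta} {y} (δ⇒≡ p) = pa

    dependent-ta-tb-ab₁ : ∀ {P} → (∀ i → P (rest i)) → P (el (f ta)) → P (el (f tb)) → P (el (f ab₁)) → ¬ Free N P
    dependent-ta-tb-ab₁ {P} onBC pa pb p1 with Z , cZ , Z⊑ , Z∘f ← Z₁ = lift-dependent {P} false cZ Z⊑ onBC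
      (λ p → ⊥-elim (true≢false p (lift-q false {Z} Z∘f))) (λ ()) onf {el (f ta)} (lift-e false {Z} Z∘f)
      where
      onf : ∀ y → lift A X e false Z ∋ el (f y) → P (el (f y))
      onf ta  _ = pa
      onf tb  _ = pb
      onf ab₁ _ = p1
      onf ab₂ p = ⊥-elim (true≢false p (lift-f false {Z} Z∘f ab₂ λ ()))

    dependent-q-ab₁-ab₂ : ∀ {P} → (∀ i → P (rest i)) → P q → P (el (f ab₁)) → P (el (f ab₂)) → ¬ Free N P
    dependent-q-ab₁-ab₂ {P} onBC pq p1 p2 with Z , cZ , Z⊑ , Z∘f ← Z₃ = lift-dependent {P} false cZ Z⊑ onBC
      (λ _ → pq) (λ ()) onf {el (f ab₁)} (lift-f false {Z} Z∘f ab₁ λ ())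
      where
      onf : ∀ y → lift A X e false Z ∋ el (f y) → P (el (f y))
      onf ta  p = ⊥-elim (true≢false p (lift-e false {Z} Z∘f))
      onf tb  p = ⊥-elim (true≢false p (lift-f false {Z} Z∘f tb λ ()))
      onf ab₁ _ = p1
      onf ab₂ _ = p2

    dependent-γ-tb-ab₂ : ∀ {P} → (∀ i → P (rest i)) → P γ → P (el (f tb)) → P (el (f ab₂)) → ¬ Free N P
    dependent-γ-tb-ab₂ {P} onBC pγ pb p2 with Z , cZ , Z⊑ , Z∘f ← Z₂ = lift-dependent {P} true cZ Z⊑ onBC
      (λ p → ⊥-elim (true≢false p (lift-q true {Z} Z∘f))) (λ _ → pγ) onf {γ} refl
      where
      onf : ∀ y → lift A X e true Z ∋ el (f y) → P (el (f y))
      onf ta  p = ⊥-elim (true≢false p (lift-e true {Z} Z∘f))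
      onf tb  _ = pb
      onf ab₁ p = ⊥-elim (true≢false p (lift-f true {Z} Z∘f ab₁ λ ()))
      onf ab₂ _ = p2

    -- For q as for tb, every exchange other than the one with ab₁ closes a triangle of K₄.
    not-orderable : ∀ σ → Injective _≡_ _≡_ σ →
      (∀ l → Free N (Range (path₁ [ l ≔ path₂ (σ l) ])) × Free N (Range (path₂ [ σ l ≔ path₁ l ])) ×
             (∀ l′ → path₂ (σ l) ≡ path₁ l′ → l′ ≡ l)) → ⊥
    not-orderable σ σ-inj exchange = contradiction (σ-inj (trans σ-q (sym σ-tb))) λ ()
      where
      σ-q : σ zero ≡ suc (suc zero)
      σ-q with σ zero | exchange zero
      ... | zero | _ , free , _ = ⊥-elim (dependent-q-ab₁-ab₂ (λ i → suc (suc (suc i)) , refl)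
              (zero , refl) (suc (suc zero) , refl) (suc zero , refl) free)
      ... | suc zero | free , _ = ⊥-elim (dependent-γ-tb-ab₂ (λ i → suc (suc (suc i)) , refl)
              (suc zero , refl) (suc (suc zero) , refl) (zero , refl) free)
      ... | suc (suc zero) | _ = refl
      ... | suc (suc (suc i)) | _ , _ , new with () ← new (suc (suc (suc i))) refl
      σ-tb : σ (suc (suc zero)) ≡ suc (suc zero)
      σ-tb with σ (suc (suc zero)) | exchange (suc (suc zero))
      ... | zero | free , _ = ⊥-elim (dependent-q-γ-ta (λ i → suc (suc (suc i)) , refl)
              (zero , refl) (suc zero , refl) (suc (suc zero) , refl) free)
      ... | suc zero | _ , free , _ = ⊥-elim (dependent-ta-tb-ab₁ (λ i → suc (suc (suc i)) , refl)
              (zero , refl) (suc zero , refl) (suc (suc zero) , refl) free)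
      ... | suc (suc zero) | _ = refl
      ... | suc (suc (suc i)) | _ , _ , new with () ← new (suc (suc (suc i))) refl

    not-gammoid : ¬ IsGammoid (VecMatroid N)
    not-gammoid (Γ , emb , _ , T , lk) = refute (base-orderable
        (free⇒linkage N lk path₁ path₁-inj path₁-free) (free⇒linkage N lk path₂ path₂-inj path₂-free))
      where
      Link : (Fin (suc (suc (suc b))) → Fin (nW Γ)) → Set
      Link = Linkage {arc = λ u v → arc Γ u v ≡ true} {T = _∈ T}
      refute : (∃[ σ ] Injective _≡_ _≡_ σ × (∀ l →
        Link ((emb ∘ path₁) [ l ≔ emb (path₂ (σ l)) ]) × Link ((emb ∘ path₂) [ σ l ≔ emb (path₁ l) ]) ×
        (∀ l′ → emb (path₂ (σ l)) ≡ emb (path₁ l′) → l′ ≡ l))) → ⊥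
      refute (σ , σ-inj , exchange) = not-orderable σ σ-inj λ l → let link₁ , link₂ , fresh = exchange l in
        linkage⇒free N lk (path₁ [ l ≔ path₂ (σ l) ]) (≔-∘ emb path₁ l (path₂ (σ l))) link₁ ,
        linkage⇒free N lk (path₂ [ σ l ≔ path₁ l ]) (≔-∘ emb path₂ (σ l) (path₁ l)) link₂ ,
        λ l′ eq → fresh l′ (cong emb eq)

minor⇒¬gammoid : ∀ {r n} {A : Matrix r n} {B : Matroid n} → Represents A B → HasMinor B (CycleMatroid G₈) →
  ¬ (∀ (X : Subset n) (e : Fin n) → 2 ≤ ∣ X ∣ → e ∈ X → IsGammoid (VecMatroid (esSplit A X e)))
minor⇒¬gammoid rep (C , D , _ , BC , BC⊆C , _ , _ , f , f-inj , f∉ , _ , minor) gammoid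
  with b , c , c-inj , c∈ , c-onto ← enumerate BC =
  K₄.not-gammoid rep f-inj f∉BC minor c-inj c∈ c-onto
    (gammoid _ _ (2≤∣X∣ rep f-inj f∉BC minor) (e∈X rep f-inj f∉BC minor))
  where
  f∉BC : ∀ y → f y ∉ BC
  f∉BC y fy∈ = proj₁ (f∉ y) (BC⊆C fy∈)

theorem4p2 : ∀ {n} (B : Matroid n) → IsGraphic B →
    ((∀ {r} (A : Matrix r n) → Represents A B →
    ∀ (X : Subset n) (e : Fin n) → 2 ≤ ∣ X ∣ → e ∈ X →
    IsBinaryGammoid (VecMatroid (esSplit A X e)))
    ⇔ (¬ HasMinor B (CycleMatroid G₈)))
theorem4p2 {n} B (G , graphic) = mk⇔
  (λ splits minor → minor⇒¬gammoid {A = incidence G} rep minor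
    λ X e 2≤∣X∣ e∈X → proj₂ (splits (incidence G) rep X e 2≤∣X∣ e∈X))
  (λ noMinor {r} A repA X e _ e∈X → (suc r , esSplit A X e , λ I → mk⇔ id id) , split noMinor A repA e∈X)
  where
  rep : Represents (incidence G) B
  rep I = mk⇔ (Equivalence.to (incidence-represents G I) ∘ Equivalence.to (graphic I))
              (Equivalence.from (graphic I) ∘ Equivalence.from (incidence-represents G I))
  split : ¬ HasMinor B (CycleMatroid G₈) → ∀ {r} (A : Matrix r n) → Represents A B →
          ∀ {X e} → e ∈ X → IsGammoid (VecMatroid (esSplit A X e))
  split noMinor A repA {X} {e} e∈X = esSplit-gammoid A X e (∈⇒lookup e∈X)
    λ circ x≢y y≢z x≢z Cx Cy Cz cT Cu Tu Cv Tv →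
      noMinor (Crosses⇒minor repA circ x≢y y≢z x≢z Cx Cy Cz (cT , (_ , Cu , Tu) , (_ , Cv , Tv)))
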